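{- Let $n\ge 1$ be an integer and suppose that the Lonely Runner Conjecture is true for $n$ runners. Let $v_1,\dots,v_n$ be positive integers with $\gcd(v_1,\dots,v_n)=1$ and $$\sum_{S\subseteq [n]} v_S > \binom{n+1}{2}^{n-1}.$$ Then the Lonely Runner Conjecture is true for the $n+1$ runners with velocities $0,v_1,\dots,v_n$, that is, there is some $t\in\mathbb{R}$ such that $\|v_i t\|\ge \frac{1}{n+1}$ for every $i$ with $1\le i\le n$.
   Context: For $x\in\mathbb{R}$, $\|x\|$ denotes the distance from $x$ to a nearest integer. "The Lonely Runner Conjecture is true for $m+1$ runners" means: for all non-zero real numbers $w_1,\dots,w_m$ there is some $t\in\mathbb{R}$ such that $\|w_i t\|\ge\frac{1}{m+1}$ for all $1\le i\le m$ (so "for $n$ runners" is the statement with $n-1$ non-zero velocities; for zero velocities it is vacuous). Here $[n]=\{1,\dots,n\}$ and, for $S\subseteq[n]$, $v_S:=\gcd(v_i: i\in S)$, with $v_\emptyset=0$. -}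

module Defs where

open import Data.Fin.Base using (Fin)
open import Data.Fin.Subset using (Subset; inside; outside)
open import Data.Fin.Subset.Properties using (_∈?_)
open import Data.Integer.Base as ℤ using (+_)
import Data.Integer.DivMod as ℤ
import Data.Integer.Properties as ℤ
open import Data.List.Base using (List; []; _∷_; _++_; map; filter; foldr; allFin)
open import Data.Nat.Base as ℕ using (ℕ; zero; suc; pred)
open import Data.Nat.GCD using (gcd)
open import Data.Nat.ListAction using (sum)
import Data.Nat.Properties as ℕ
open import Data.Product.Base using (∃; _×_; _,_)
open import Data.Rational.Base
open import Data.Rational.Properties
open import Data.Rational.Solver using (module +-*-Solver)
import Data.Rational.Unnormalised.Base as ℚᵘ
import Data.Rational.Unnormalised.Properties as ℚᵘ
open import Data.Sum.Base using (inj₁; inj₂)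
open import Data.Vec.Base using ([]; _∷_)
open import Data.Vec.Functional using (Vector)
open import Relation.Binary.PropositionalEquality
  using (_≡_; refl; sym; trans; cong; cong₂; subst; subst₂)
open import Relation.Nullary.Decidable.Core using (yes; no)
open import Relation.Nullary.Negation.Core using (¬_)

‖_‖ℚ : ℚ → ℚ
‖ q ‖ℚ = (q - floor q / 1) ⊓ (ℤ.suc (floor q) / 1 - q)

private
  toℚᵘ-/1 : ∀ k → toℚᵘ (k / 1) ℚᵘ.≃ ℚᵘ.mkℚᵘ k 0
  toℚᵘ-/1 k = toℚᵘ-fromℚᵘ (ℚᵘ.mkℚᵘ k 0)

  /1-mono-≤ : ∀ {j k} → j ℤ.≤ k → j / 1 ≤ k / 1
  /1-mono-≤ {j} {k} j≤k = toℚᵘ-cancel-≤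
    (ℚᵘ.≤-respˡ-≃ (ℚᵘ.≃-sym (toℚᵘ-/1 j))
    (ℚᵘ.≤-respʳ-≃ (ℚᵘ.≃-sym (toℚᵘ-/1 k))
    (ℚᵘ.*≤* (ℤ.*-monoʳ-≤-nonNeg (+ 1) j≤k))))

  0≤q-p : ∀ {p q} → p ≤ q → 0ℚ ≤ q - p
  0≤q-p {p} {q} p≤q = subst (_≤ q - p) (+-inverseʳ p) (+-monoˡ-≤ (- p) p≤q)

  p≤∣p∣ : ∀ p → p ≤ ∣ p ∣
  p≤∣p∣ p with ≤-total 0ℚ p
  ... | inj₁ 0≤p = ≤-reflexive (sym (0≤p⇒∣p∣≡p 0≤p))
  ... | inj₂ p≤0 = ≤-trans p≤0 (0≤∣p∣ p)

  neg-sub : ∀ p q → - (p - q) ≡ q - p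
  neg-sub = solve 2 (λ p q → :- (p :- q) := q :- p) refl
    where open +-*-Solver

  ∣p-q∣≡∣q-p∣ : ∀ p q → ∣ p - q ∣ ≡ ∣ q - p ∣
  ∣p-q∣≡∣q-p∣ p q = trans (sym (∣-p∣≡∣p∣ (p - q))) (cong ∣_∣ (neg-sub p q))

floor-≤ : ∀ q → floor q / 1 ≤ q
floor-≤ q@record{} = toℚᵘ-cancel-≤
  (ℚᵘ.≤-respˡ-≃ (ℚᵘ.≃-sym (toℚᵘ-/1 (floor q)))
  (ℚᵘ.*≤* (subst (floor q ℤ.* ↧ q ℤ.≤_) (sym (ℤ.*-identityʳ (↥ q)))
    (ℤ.[n/d]*d≤n (↥ q) (↧ q)))))

≤-suc-floor : ∀ q → q ≤ ℤ.suc (floor q) / 1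
≤-suc-floor q@record{} = toℚᵘ-cancel-≤
  (ℚᵘ.≤-respʳ-≃ (ℚᵘ.≃-sym (toℚᵘ-/1 (ℤ.suc (floor q))))
  (ℚᵘ.*≤* (subst₂ ℤ._≤_ (sym (ℤ.*-identityʳ (↥ q)))
    (cong (λ z → ℤ.suc z ℤ.* ↧ q) (sym (ℤ.div-pos-is-/ℕ (↥ q) (↧ₙ q))))
    (ℤ.<⇒≤ (ℤ.n<s[n/ℕd]*d (↥ q) (↧ₙ q))))))

‖‖ℚ-minimal : ∀ q k → ‖ q ‖ℚ ≤ ∣ q - k / 1 ∣
‖‖ℚ-minimal q k with k ℤ.≤? floor q
... | yes k≤⌊q⌋ = ≤-trans (p⊓q≤p _ (ℤ.suc (floor q) / 1 - q))
  (≤-trans (+-monoʳ-≤ q (neg-antimono-≤ (/1-mono-≤ k≤⌊q⌋))) (p≤∣p∣ _))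
... | no  k≰⌊q⌋ = ≤-trans (p⊓q≤q (q - floor q / 1) _)
  (≤-trans (+-monoˡ-≤ (- q) (/1-mono-≤ (ℤ.i<j⇒suc[i]≤j (ℤ.≰⇒> k≰⌊q⌋))))
  (≤-trans (p≤∣p∣ _) (≤-reflexive (∣p-q∣≡∣q-p∣ (k / 1) q))))

‖‖ℚ-attained : ∀ q → ∃ λ k → ‖ q ‖ℚ ≡ ∣ q - k / 1 ∣
‖‖ℚ-attained q with ⊓-sel (q - floor q / 1) (ℤ.suc (floor q) / 1 - q)
... | inj₁ eq = floor q ,
  trans eq (sym (0≤p⇒∣p∣≡p (0≤q-p (floor-≤ q))))
... | inj₂ eq = ℤ.suc (floor q) ,
  trans eq (trans (sym (0≤p⇒∣p∣≡p (0≤q-p (≤-suc-floor q))))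
                  (∣p-q∣≡∣q-p∣ (ℤ.suc (floor q) / 1) q))

private
  ‖‖ℚ-≤ : ∀ p q → ‖ p ‖ℚ - ‖ q ‖ℚ ≤ ∣ p - q ∣
  ‖‖ℚ-≤ p q with ‖‖ℚ-attained q
  ... | k , eq = begin
    ‖ p ‖ℚ - ‖ q ‖ℚ
      ≤⟨ +-monoˡ-≤ (- ‖ q ‖ℚ) (‖‖ℚ-minimal p k) ⟩
    ∣ p - k / 1 ∣ - ‖ q ‖ℚ
      ≡⟨ cong₂ (λ x y → ∣ x ∣ - y) (split p q (k / 1)) eq ⟩
    ∣ (p - q) + (q - k / 1) ∣ - ∣ q - k / 1 ∣
      ≤⟨ +-monoˡ-≤ (- ∣ q - k / 1 ∣) (∣p+q∣≤∣p∣+∣q∣ (p - q) (q - k / 1)) ⟩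
    ∣ p - q ∣ + ∣ q - k / 1 ∣ - ∣ q - k / 1 ∣
      ≡⟨ cancel ∣ p - q ∣ ∣ q - k / 1 ∣ ⟩
    ∣ p - q ∣ ∎
    where
    open ≤-Reasoning
    open +-*-Solver
    split : ∀ p q r → p - r ≡ (p - q) + (q - r)
    split = solve 3 (λ p q r → p :- r := (p :- q) :+ (q :- r)) refl
    cancel : ∀ p q → p + q - q ≡ p
    cancel = solve 2 (λ p q → p :+ q :- q := p) refl

‖‖ℚ-lipschitz : ∀ p q → ∣ ‖ p ‖ℚ - ‖ q ‖ℚ ∣ ≤ ∣ p - q ∣
‖‖ℚ-lipschitz p q with ∣p∣≡p∨∣p∣≡-p (‖ p ‖ℚ - ‖ q ‖ℚ)
... | inj₁ eq = subst (_≤ ∣ p - q ∣) (sym eq) (‖‖ℚ-≤ p q)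
... | inj₂ eq = subst₂ _≤_ (sym (trans eq (neg-sub ‖ p ‖ℚ ‖ q ‖ℚ)))
                           (∣p-q∣≡∣q-p∣ q p) (‖‖ℚ-≤ q p)

-- Cauchy sequences with modulus; _≃ℝ_ below is the intended equality.
record ℝ : Set where
  constructor mkℝ
  field
    seq    : ℕ → ℚ
    cauchy : ∀ ε → 0ℚ < ε →
             ∃ λ N → ∀ m n → N ℕ.≤ m → N ℕ.≤ n → ∣ seq m - seq n ∣ < ε

open ℝ public

infix 4 _≃ℝ_ _≤ℝ_

_≃ℝ_ : ℝ → ℝ → Set
x ≃ℝ y = ∀ ε → 0ℚ < ε → ∃ λ N → ∀ n → N ℕ.≤ n → ∣ seq x n - seq y n ∣ < ε

_≤ℝ_ : ℝ → ℝ → Set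
x ≤ℝ y = ∀ ε → 0ℚ < ε → ∃ λ N → ∀ n → N ℕ.≤ n → seq x n < seq y n + ε

fromℚ : ℚ → ℝ
fromℚ q = mkℝ (λ _ → q) λ ε 0<ε → 0 , λ _ _ _ _ →
  subst (_< ε) (sym (cong ∣_∣ (+-inverseʳ q))) 0<ε

fromℕ : ℕ → ℝ
fromℕ n = fromℚ (+ n / 1)

private
  tail-bound : ∀ x → ∃ λ N → ∃ λ b → 0ℚ < b × (∀ n → N ℕ.≤ n → ∣ seq x n ∣ < b)
  tail-bound x with cauchy x 1ℚ (positive⁻¹ 1ℚ)
  ... | N , close = N , 1ℚ + ∣ seq x N ∣ ,
    +-mono-<-≤ (positive⁻¹ 1ℚ) (0≤∣p∣ (seq x N)) , λ n N≤n → begin-strict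
    ∣ seq x n ∣                           ≡⟨ cong ∣_∣ (split (seq x n) (seq x N)) ⟩
    ∣ (seq x n - seq x N) + seq x N ∣     ≤⟨ ∣p+q∣≤∣p∣+∣q∣ (seq x n - seq x N) (seq x N) ⟩
    ∣ seq x n - seq x N ∣ + ∣ seq x N ∣   <⟨ +-monoˡ-< ∣ seq x N ∣ (close n N N≤n ℕ.≤-refl) ⟩
    1ℚ + ∣ seq x N ∣                      ∎
    where
    open ≤-Reasoning
    open +-*-Solver
    split : ∀ p q → p ≡ (p - q) + q
    split = solve 2 (λ p q → p := (p :- q) :+ q) refl

  product-< : ∀ {p q r s} → ∣ p ∣ < r → ∣ q ∣ < s → ∣ p * q ∣ < r * s
  product-< {p} {q} {r} {s} p<r q<s = begin-strict
    ∣ p * q ∣      ≡⟨ ∣p*q∣≡∣p∣*∣q∣ p q ⟩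
    ∣ p ∣ * ∣ q ∣  ≤⟨ *-monoʳ-≤-nonNeg ∣ q ∣ {{∣-∣-nonNeg q}} (<⇒≤ p<r) ⟩
    r * ∣ q ∣      <⟨ *-monoʳ-<-pos r {{positive (≤-<-trans (0≤∣p∣ p) p<r)}} q<s ⟩
    r * s          ∎
    where open ≤-Reasoning

  product-close : ∀ {p p′ q q′ b c δ} →
                  ∣ p ∣ < b → ∣ q′ ∣ < c → ∣ p - p′ ∣ < δ → ∣ q - q′ ∣ < δ →
                  ∣ p * q - p′ * q′ ∣ < b * δ + δ * c
  product-close {p} {p′} {q} {q′} {b} {c} {δ} p<b q′<c p~p′ q~q′ = begin-strict
    ∣ p * q - p′ * q′ ∣
      ≡⟨ cong ∣_∣ (split p q p′ q′) ⟩
    ∣ p * (q - q′) + (p - p′) * q′ ∣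
      ≤⟨ ∣p+q∣≤∣p∣+∣q∣ (p * (q - q′)) ((p - p′) * q′) ⟩
    ∣ p * (q - q′) ∣ + ∣ (p - p′) * q′ ∣
      <⟨ +-mono-< (product-< {p} {q - q′} p<b q~q′) (product-< {p - p′} {q′} p~p′ q′<c) ⟩
    b * δ + δ * c ∎
    where
    open ≤-Reasoning
    open +-*-Solver
    split : ∀ p q r s → p * q - r * s ≡ p * (q - s) + (p - r) * s
    split = solve 4 (λ p q r s → p :* q :- r :* s := p :* (q :- s) :+ (p :- r) :* s) refl

  product-modulus : ∀ b c ε → 0ℚ < b → 0ℚ < c → 0ℚ < ε →
                    ∃ λ δ → 0ℚ < δ × b * δ + δ * c ≡ ε
  product-modulus b c ε 0<b 0<c 0<ε = ε * i , 0<δ , total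
    where
    b+c-pos : Positive (b + c)
    b+c-pos = pos+pos⇒pos b {{positive 0<b}} c {{positive 0<c}}

    instance
      b+c-nonZero : NonZero (b + c)
      b+c-nonZero = pos⇒nonZero (b + c) {{b+c-pos}}

    i : ℚ
    i = 1/ (b + c)

    0<δ : 0ℚ < ε * i
    0<δ = positive⁻¹ (ε * i)
      {{pos*pos⇒pos ε {{positive 0<ε}} i {{1/pos⇒pos (b + c) {{b+c-pos}}}}}}

    rearrange : ∀ b c e i → b * (e * i) + (e * i) * c ≡ e * ((b + c) * i)
    rearrange = solve 4 (λ b c e i →
      b :* (e :* i) :+ (e :* i) :* c := e :* ((b :+ c) :* i)) refl
      where open +-*-Solver

    total : b * (ε * i) + (ε * i) * c ≡ ε
    total = trans (rearrange b c ε i)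
                  (trans (cong (ε *_) (*-inverseʳ (b + c))) (*-identityʳ ε))

  *-cauchy : ∀ x y ε → 0ℚ < ε → ∃ λ N → ∀ m n → N ℕ.≤ m → N ℕ.≤ n →
             ∣ seq x m * seq y m - seq x n * seq y n ∣ < ε
  *-cauchy x y ε 0<ε =
    let N₁ , b , 0<b , bound-x = tail-bound x
        N₂ , c , 0<c , bound-y = tail-bound y
        δ , 0<δ , total        = product-modulus b c ε 0<b 0<c 0<ε
        N₃ , close-x           = cauchy x δ 0<δ
        N₄ , close-y           = cauchy y δ 0<δ
        M₁ = N₁ ℕ.⊔ N₂
        M₂ = N₃ ℕ.⊔ N₄
        N₁≤ = λ {k} (N≤k : M₁ ℕ.⊔ M₂ ℕ.≤ k) → ℕ.m⊔n≤o⇒m≤o N₁ N₂ (ℕ.m⊔n≤o⇒m≤o M₁ M₂ N≤k)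
        N₂≤ = λ {k} (N≤k : M₁ ℕ.⊔ M₂ ℕ.≤ k) → ℕ.m⊔n≤o⇒n≤o N₁ N₂ (ℕ.m⊔n≤o⇒m≤o M₁ M₂ N≤k)
        N₃≤ = λ {k} (N≤k : M₁ ℕ.⊔ M₂ ℕ.≤ k) → ℕ.m⊔n≤o⇒m≤o N₃ N₄ (ℕ.m⊔n≤o⇒n≤o M₁ M₂ N≤k)
        N₄≤ = λ {k} (N≤k : M₁ ℕ.⊔ M₂ ℕ.≤ k) → ℕ.m⊔n≤o⇒n≤o N₃ N₄ (ℕ.m⊔n≤o⇒n≤o M₁ M₂ N≤k)
    in M₁ ℕ.⊔ M₂ , λ m n N≤m N≤n →
      subst (∣ seq x m * seq y m - seq x n * seq y n ∣ <_) total
        (product-close (bound-x m (N₁≤ N≤m)) (bound-y n (N₂≤ N≤n))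
                       (close-x m n (N₃≤ N≤m) (N₃≤ N≤n))
                       (close-y m n (N₄≤ N≤m) (N₄≤ N≤n)))

infixl 7 _*ℝ_

_*ℝ_ : ℝ → ℝ → ℝ
x *ℝ y = mkℝ (λ n → seq x n * seq y n) (*-cauchy x y)

-- Since ‖_‖ℚ is 1-Lipschitz, it extends to ℝ by applying it termwise.
‖_‖ : ℝ → ℝ
‖ x ‖ = mkℝ (λ n → ‖ seq x n ‖ℚ) λ ε 0<ε →
  let N , close = cauchy x ε 0<ε in
  N , λ m n N≤m N≤n →
    ≤-<-trans (‖‖ℚ-lipschitz (seq x m) (seq x n)) (close m n N≤m N≤n)

LonelyAt : ∀ {m} → Vector ℝ m → ℝ → Set
LonelyAt {m} w t = ∀ i → fromℚ (+ 1 / suc m) ≤ℝ ‖ w i *ℝ t ‖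

-- The conjecture for n ≥ 1 runners, one of which is stationary.
-- The existence of t is the classical one, i.e. ¬ ¬ ∃: the constructive
-- ∃ would require t to be computed from w, which is impossible
-- continuously, e.g. for velocities near (1 , 2), and would make the
-- conjecture false in continuous models. As the conjecture is only used
-- as a hypothesis, ¬ ¬ ∃ is also the weaker assumption.
LonelyRunnerConjecture : ℕ → Set
LonelyRunnerConjecture n =
  (w : Vector ℝ (pred n)) → (∀ i → ¬ w i ≃ℝ fromℕ 0) → ¬ ¬ ∃ (LonelyAt w)

-- gcd has unit 0, so the empty subset gives 0.
gcdOver : ∀ {n} → Vector ℕ n → Subset n → ℕ
gcdOver {n} v S = foldr gcd 0 (map v (filter (_∈? S) (allFin n)))

subsets : ∀ n → List (Subset n)
subsets zero    = [] ∷ []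
subsets (suc n) = map (outside ∷_) (subsets n) ++ map (inside ∷_) (subsets n)

∑gcd : ∀ {n} → Vector ℕ n → ℕ
∑gcd {n} v = sum (map (gcdOver v) (subsets n))

{-# OPTIONS --safe #-}

-- View v modulo ℤⁿ. The pairs (S , a) with a < v_S number ∑_S v_S and give
-- distinct lattice points of the cube [0,1]ⁿ projected along v. When there are
-- more than N^(n-1) of them, N = n (n + 1) / 2, two agree modulo N and v, and
-- dividing their difference by N gives an integer vector z, not parallel to v,
-- with |z - τ v| ≤ 1 / N in each coordinate for some τ.
--
-- Choose i and j with adjacent distinct slopes z i / v i < z j / v j and let
-- u = v (z i + z j) - z (v i + v j). All u k are non-zero and u j = - u i, so
-- the conjecture for n runners gives t with ‖ u k t ‖ ≥ 1 / n for all k. Moving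
-- by an integer multiple of z - τ v, the position u t is approximated by a
-- multiple of v within 1 / (2 N) = 1 / n - 1 / (n + 1).
--
-- The conjecture provides t only up to ¬ ¬; the velocities u being integers, t
-- can be rounded to a fraction with a fixed denominator, found by finite search.
module Submission where

open import Defs
open import Data.Fin.Subset using (⊤)
open import Data.Nat.Base using (ℕ; suc; pred; _≤_; _<_; _^_)
open import Data.Nat.Combinatorics using (_C_)
open import Data.Product.Base using (∃)
open import Data.Vec.Functional using (Vector)
open import Relation.Binary.PropositionalEquality using (_≡_)

open import Data.Fin.Base using (Fin; zero; suc; toℕ; fromℕ<; punchIn; punchOut; remQuot; combine; funToFin; finToFun)
open import Data.Fin.Induction using (spo-wellFounded)
import Data.Fin.Properties as Fin
open import Data.Fin.Subset using (Subset; inside; outside; _∈_; _∉_; _⊆_)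
open import Data.Fin.Subset.Properties using (_∈?_; ⊆-antisym)
open import Data.Integer.Base as ℤ using (ℤ; +_; ∣_∣)
import Data.Integer.DivMod as ℤ
open import Data.Integer.Divisibility.Signed using (∣ᵤ⇒∣) renaming (divides to dividesℤ)
import Data.Integer.Properties as ℤ
import Data.Integer.Tactic.RingSolver as ℤ
open import Data.List.Base using (List; []; _∷_; map; foldr; allFin; concatMap; upTo; length; lookup; tabulate)
open import Data.List.Membership.Propositional using () renaming (_∈_ to _∈ₗ_)
open import Data.List.Membership.Propositional.Properties
  using (∈-filter⁺; ∈-map⁺; ∈-map⁻; ∈-allFin; ∈-lookup; ∈-upTo⁻; ∈-tabulate⁺)
open import Data.List.Properties using (length-++; length-map; length-upTo)
open import Data.List.Relation.Unary.All as All using (All; []; _∷_)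
import Data.List.Relation.Unary.All.Properties as All
open import Data.List.Relation.Unary.AllPairs using ([]; _∷_)
open import Data.List.Relation.Unary.Any using (here; there)
open import Data.List.Relation.Unary.Unique.Propositional using (Unique)
import Data.List.Relation.Unary.Unique.Propositional.Properties as Unique
open import Data.Nat.Base as ℕ using (zero; _+_; _*_; NonZero)
open import Data.Nat.Combinatorics using (nC1≡n; nCk+nC[k+1]≡[n+1]C[k+1])
open import Data.Nat.DivMod using (_/_; _%_; _mod_; m≡m%n+[m/n]*n; m%n<n)
open import Data.Nat.Divisibility using (_∣_; divides; ∣-trans; 0∣⇒≡0; _∣0)
open import Data.Nat.GCD using (gcd; gcd[m,n]∣m; gcd[m,n]∣n; gcd-greatest; c*gcd[m,n]≡gcd[cm,cn])
open import Data.Nat.ListAction using (sum; product)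
open import Data.Nat.ListAction.Properties using (∈⇒∣product; product≢0)
import Data.Nat.Properties as ℕ
import Data.Nat.Tactic.RingSolver as ℕ
open import Data.Product.Base using (∃₂; _×_; _,_; proj₁; proj₂; uncurry)
open import Data.Product.Properties using (,-injectiveʳ)
open import Data.Rational.Base as ℚ using (ℚ; toℚᵘ; 0ℚ; 1ℚ)
import Data.Rational.Properties as ℚ
import Data.Rational.Unnormalised.Base as ℚᵘ
import Data.Rational.Unnormalised.Properties as ℚᵘ
open import Data.Sum.Base using (inj₁; inj₂)
open import Data.Vec.Base using ([]; _∷_)
import Data.Vec.Properties as Vec
open import Function.Base using (_∘_)
open import Induction.WellFounded using (Acc; acc; WellFounded)
open import Relation.Binary.PropositionalEquality
open import Relation.Nullary.Decidable.Core using (Dec; yes; no; _×-dec_; decidable-stable; map′)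
open import Relation.Nullary.Negation.Core using (¬_; contradiction)
import Algebra.Properties.AbelianGroup ℤ.+-0-abelianGroup as ℤ-group
open import Algebra.Properties.CommutativeSemigroup ℤ.*-commutativeSemigroup using (xy∙z≈xz∙y)

-- gcdOver and the index set of the lattice points

foldr-gcd-∣ : ∀ {xs x} → x ∈ₗ xs → foldr gcd 0 xs ∣ x
foldr-gcd-∣ {y ∷ xs} (here refl) = gcd[m,n]∣m y (foldr gcd 0 xs)
foldr-gcd-∣ {y ∷ xs} (there x∈xs) =
  ∣-trans (gcd[m,n]∣n y (foldr gcd 0 xs)) (foldr-gcd-∣ x∈xs)

-- The factor `c` makes this usable as Euclid's lemma: if `d` divides every `c * x` and the gcd is
-- 1, then `d` divides `c`.
foldr-gcd-greatest : ∀ {d} c {xs} → All (λ x → d ∣ c * x) xs → d ∣ c * foldr gcd 0 xs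
foldr-gcd-greatest {d} c [] = subst (d ∣_) (sym (ℕ.*-zeroʳ c)) (d ∣0)
foldr-gcd-greatest {d} c {x ∷ xs} (d∣cx ∷ d∣cxs) =
  subst (d ∣_) (sym (c*gcd[m,n]≡gcd[cm,cn] c x (foldr gcd 0 xs)))
    (gcd-greatest d∣cx (foldr-gcd-greatest c d∣cxs))

gcdOver-∣ : ∀ {n} (v : Vector ℕ n) {S i} → i ∈ S → gcdOver v S ∣ v i
gcdOver-∣ v {S} {i} i∈S = foldr-gcd-∣ (∈-map⁺ v (∈-filter⁺ (_∈? S) (∈-allFin i) i∈S))

gcdOver-greatest : ∀ {n} (v : Vector ℕ n) {S d} c →
                   (∀ {i} → i ∈ S → d ∣ c * v i) → d ∣ c * gcdOver v S
gcdOver-greatest v {S} c d∣cv = foldr-gcd-greatest c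
  (All.map⁺ (All.map d∣cv (All.all-filter (_∈? S) (allFin _))))

-- Over an empty set every entry is vacuously a multiple of 0, so 0 divides the gcd. Hence the
-- support of a zonotope point, whose level is positive, has an element.
gcdOver-nonempty : ∀ {n} (v : Vector ℕ n) {S} → 0 < gcdOver v S → ¬ (∀ i → i ∉ S)
gcdOver-nonempty v {S} 0<g S-empty = ℕ.<⇒≢ 0<g (sym (trans (sym (ℕ.*-identityˡ _))
  (0∣⇒≡0 (gcdOver-greatest v {S} 1 λ {i} i∈S → contradiction i∈S (S-empty i)))))

lookup-injective : ∀ {A : Set} {xs : List A} → Unique xs →
                   ∀ {i j} → lookup xs i ≡ lookup xs j → i ≡ j
lookup-injective (_ ∷ _) {zero} {zero} _ = refl
lookup-injective (x∉xs ∷ _) {zero} {suc j} eq = contradiction eq (All.lookup x∉xs (∈-lookup j))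
lookup-injective (x∉xs ∷ _) {suc i} {zero} eq = contradiction (sym eq) (All.lookup x∉xs (∈-lookup i))
lookup-injective (_ ∷ xs!) {suc i} {suc j} eq = cong suc (lookup-injective xs! eq)

subsets-unique : ∀ n → Unique (subsets n)
subsets-unique zero = [] ∷ []
subsets-unique (suc n) = Unique.++⁺
  (Unique.map⁺ Vec.∷-injectiveʳ (subsets-unique n))
  (Unique.map⁺ Vec.∷-injectiveʳ (subsets-unique n))
  λ (∈out , ∈in) → disjoint (∈-map⁻ (outside ∷_) ∈out) (∈-map⁻ (inside ∷_) ∈in)
  where
  disjoint : ∀ {S : Subset (suc n)} →
             (∃ λ T → T ∈ₗ subsets n × S ≡ outside ∷ T) →
             ¬ (∃ λ T → T ∈ₗ subsets n × S ≡ inside ∷ T)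
  disjoint (_ , _ , refl) (_ , _ , ())

module _ {A : Set} (f : A → ℕ) where

  pairsBelow : List A → List (A × ℕ)
  pairsBelow = concatMap λ x → map (x ,_) (upTo (f x))

  length-pairsBelow : ∀ xs → length (pairsBelow xs) ≡ sum (map f xs)
  length-pairsBelow [] = refl
  length-pairsBelow (x ∷ xs) = trans (length-++ (map (x ,_) (upTo (f x))))
    (cong₂ _+_ (trans (length-map (x ,_) (upTo (f x))) (length-upTo (f x)))
               (length-pairsBelow xs))

  pairsBelow-< : ∀ xs → All (λ p → proj₂ p < f (proj₁ p)) (pairsBelow xs)
  pairsBelow-< [] = []
  pairsBelow-< (x ∷ xs) = All.++⁺ (All.map⁺ (All.tabulate ∈-upTo⁻)) (pairsBelow-< xs)

  pairsBelow-∈ : ∀ xs → All (λ p → proj₁ p ∈ₗ xs) (pairsBelow xs)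
  pairsBelow-∈ [] = []
  pairsBelow-∈ (x ∷ xs) = All.++⁺ (All.map⁺ (All.tabulate λ _ → here refl))
                                  (All.map there (pairsBelow-∈ xs))

  pairsBelow-unique : ∀ {xs} → Unique xs → Unique (pairsBelow xs)
  pairsBelow-unique [] = []
  pairsBelow-unique {x ∷ xs} (x∉xs ∷ xs!) = Unique.++⁺
    (Unique.map⁺ ,-injectiveʳ (Unique.upTo⁺ (f x)))
    (pairsBelow-unique xs!)
    λ (∈x , ∈xs) → let _ , _ , eq = ∈-map⁻ (x ,_) ∈x in
      All.lookup x∉xs (All.lookup (pairsBelow-∈ xs) ∈xs) (sym (cong proj₁ eq))

-- Lattice points of the zonotope

∣m-n∣≤o : ∀ {m n o} → m ≤ o → n ≤ o → ∣ + m ℤ.- + n ∣ ≤ o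
∣m-n∣≤o {m} {n} m≤o n≤o = subst (λ x → ∣ x ∣ ≤ _) (sym (ℤ.m-n≡m⊖n m n))
  (ℕ.≤-trans (ℤ.∣m⊝n∣≤m⊔n m n) (ℕ.⊔-lub m≤o n≤o))

-- Two residues below `d` differ by less than `d`, so the multiple of `d` separating them vanishes.
-- It is applied with the product of two levels and with the modulus `N`.
bounded-multiple : ∀ {d m n q} → m < d → n < d → + m ≡ + n ℤ.+ + d ℤ.* q → q ≡ + 0
bounded-multiple {suc d} {m} {n} {q} (ℕ.s≤s m≤d) (ℕ.s≤s n≤d) eq =
  ℤ.∣i∣≡0⇒i≡0 (ℕ.n<1⇒n≡0 (ℕ.*-cancelˡ-< (suc d) ∣ q ∣ 1 (begin-strict
    suc d * ∣ q ∣          ≡⟨ ℤ.abs-* (+ suc d) q ⟨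
    ∣ + suc d ℤ.* q ∣      ≡⟨ cong ∣_∣ (cancel (+ n) (+ suc d ℤ.* q)) ⟩
    ∣ + n ℤ.+ + suc d ℤ.* q ℤ.- + n ∣ ≡⟨ cong (λ x → ∣ x ℤ.- + n ∣) eq ⟨
    ∣ + m ℤ.- + n ∣        ≤⟨ ∣m-n∣≤o m≤d n≤d ⟩
    d                      <⟨ ℕ.n<1+n d ⟩
    suc d                  ≡⟨ ℕ.*-identityʳ (suc d) ⟨
    suc d * 1              ∎)))
  where
  open ℕ.≤-Reasoning
  cancel : ∀ n x → x ≡ n ℤ.+ x ℤ.- n
  cancel = ℤ.solve-∀

-- With level = gcd (v i : i ∈ support) and t = index / level, the lattice point
-- has coord i = ⌊ t v i ⌋ + [ i ∉ support ], and offset i / level is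
-- t v i + 1 - coord i ∈ [0 , 1], equal to 1 exactly on the support, where t v i
-- is an integer.
record ZonotopePoint {n} (v : Vector ℕ n) : Set where
  field
    support     : Subset n
    level       : ℕ
    level≡      : level ≡ gcdOver v support
    index       : ℕ
    index<level : index < level
    coord       : Fin n → ℕ
    offset      : Fin n → ℕ
    split       : ∀ i → index * v i + level ≡ offset i + coord i * level
    offset-∈    : ∀ {i} → i ∈ support → offset i ≡ level
    offset-∉    : ∀ {i} → i ∉ support → offset i < level

  offset≤level : ∀ i → offset i ≤ level
  offset≤level i with i ∈? support
  ... | yes i∈S = ℕ.≤-reflexive (offset-∈ i∈S)
  ... | no  i∉S = ℕ.<⇒≤ (offset-∉ i∉S)

  offset≡ : ∀ i → + offset i ≡ + index ℤ.* + v i ℤ.+ + level ℤ.- + coord i ℤ.* + level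
  offset≡ i = trans (cancel (+ offset i) (+ coord i ℤ.* + level))
    (cong (ℤ._- + coord i ℤ.* + level) (begin
      + offset i ℤ.+ + coord i ℤ.* + level  ≡⟨ cong (λ x → + offset i ℤ.+ x) (ℤ.pos-* (coord i) level) ⟨
      + (offset i + coord i * level)        ≡⟨ cong +_ (split i) ⟨
      + (index * v i + level)               ≡⟨ cong (ℤ._+ + level) (ℤ.pos-* index (v i)) ⟩
      + index ℤ.* + v i ℤ.+ + level         ∎))
    where
    open ≡-Reasoning
    cancel : ∀ x y → x ≡ x ℤ.+ y ℤ.- y
    cancel = ℤ.solve-∀

open ZonotopePoint

zonotopePoint : ∀ {n} (v : Vector ℕ n) S {a} → a < gcdOver v S →
                ∃ λ (p : ZonotopePoint v) → support p ≡ S × index p ≡ a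
zonotopePoint {n} v S {a} a<g = record
  { support     = S
  ; level       = gcdOver v S
  ; level≡      = refl
  ; index       = a
  ; index<level = a<g
  ; coord       = λ i → proj₁ (at i)
  ; offset      = λ i → proj₁ (proj₂ (at i))
  ; split       = λ i → proj₁ (proj₂ (proj₂ (at i)))
  ; offset-∈    = λ {i} → proj₁ (proj₂ (proj₂ (proj₂ (at i))))
  ; offset-∉    = λ {i} → proj₂ (proj₂ (proj₂ (proj₂ (at i))))
  } , refl , refl
  where
  g = gcdOver v S

  instance
    g-nonZero : NonZero g
    g-nonZero = ℕ.>-nonZero (ℕ.≤-<-trans ℕ.z≤n a<g)

  at : ∀ i → ∃₂ λ y r → a * v i + g ≡ r + y * g × (i ∈ S → r ≡ g) × (i ∉ S → r < g)
  at i with i ∈? S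
  ... | yes i∈S with divides q vᵢ≡qg ← gcdOver-∣ v i∈S = a * q , g ,
    trans (ℕ.+-comm (a * v i) g)
          (cong (_+_ g) (trans (cong (a *_) vᵢ≡qg) (sym (ℕ.*-assoc a q g)))) ,
    (λ _ → refl) , λ i∉S → contradiction i∈S i∉S
  -- The successor absorbs the summand `g`, so that the offset is the plain remainder.
  ... | no i∉S = suc (a * v i / g) , a * v i % g , (begin
      a * v i + g                                 ≡⟨ cong (_+ g) (m≡m%n+[m/n]*n (a * v i) g) ⟩
      a * v i % g + a * v i / g * g + g           ≡⟨ ℕ.+-assoc (a * v i % g) _ g ⟩
      a * v i % g + (a * v i / g * g + g)         ≡⟨ cong (_+_ (a * v i % g)) (ℕ.+-comm _ g) ⟩
      a * v i % g + suc (a * v i / g) * g         ∎) ,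
    (λ i∈S → contradiction i∈S i∉S) , λ _ → m%n<n (a * v i) g
    where open ≡-Reasoning

-- Divided by g g′ this reads r / g - r′ / g′ = (a / g - a′ / g′ - ρ) v: the coordinates are
-- eliminated, and offsets are compared through the times a / g and a′ / g′ alone.
offset-identity : ∀ {g a g′ a′ ρ v y y′ r r′ : ℤ} →
  r ≡ a ℤ.* v ℤ.+ g ℤ.- y ℤ.* g → r′ ≡ a′ ℤ.* v ℤ.+ g′ ℤ.- y′ ℤ.* g′ → y ≡ y′ ℤ.+ ρ ℤ.* v →
  (g ℤ.* a′ ℤ.+ g ℤ.* g′ ℤ.* ρ) ℤ.* v ℤ.+ g′ ℤ.* r ≡ g′ ℤ.* a ℤ.* v ℤ.+ g ℤ.* r′
offset-identity {g} {a} {g′} {a′} {ρ} {v} {y′ = y′} refl refl refl =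
  identity g a g′ a′ ρ v y′
  where
  identity : ∀ g a g′ a′ ρ v y′ →
    (g ℤ.* a′ ℤ.+ g ℤ.* g′ ℤ.* ρ) ℤ.* v ℤ.+ g′ ℤ.* (a ℤ.* v ℤ.+ g ℤ.- (y′ ℤ.+ ρ ℤ.* v) ℤ.* g)
    ≡ g′ ℤ.* a ℤ.* v ℤ.+ g ℤ.* (a′ ℤ.* v ℤ.+ g′ ℤ.- y′ ℤ.* g′)
  identity = ℤ.solve-∀

-- Lattice points modulo multiples of `v`

module _ {n} {v : Vector ℕ n} where

  Translate : ZonotopePoint v → ZonotopePoint v → ℤ → Set
  Translate p p′ ρ = ∀ i → + coord p i ≡ + coord p′ i ℤ.+ ρ ℤ.* + v i

  Translate-sym : ∀ p p′ ρ → Translate p p′ ρ → Translate p′ p (ℤ.- ρ)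
  Translate-sym _ _ ρ eq i = identity (+ v i) (eq i)
    where
    cancel : ∀ y ρ v → y ≡ y ℤ.+ ρ ℤ.* v ℤ.+ ℤ.- ρ ℤ.* v
    cancel = ℤ.solve-∀
    identity : ∀ {y y′} v → y ≡ y′ ℤ.+ ρ ℤ.* v → y′ ≡ y ℤ.+ ℤ.- ρ ℤ.* v
    identity {y′ = y′} v refl = cancel y′ ρ v

  offset-translate : ∀ p p′ ρ → Translate p p′ ρ → ∀ i →
    (+ level p ℤ.* + index p′ ℤ.+ + level p ℤ.* + level p′ ℤ.* ρ) ℤ.* + v i ℤ.+ + level p′ ℤ.* + offset p i
    ≡ + level p′ ℤ.* + index p ℤ.* + v i ℤ.+ + level p ℤ.* + offset p′ i
  offset-translate p p′ ρ eq i =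
    offset-identity {+ level p} {+ index p} {+ level p′} {+ index p′} {ρ} {+ v i} {+ coord p i} {+ coord p′ i}
      (offset≡ p i) (offset≡ p′ i) (eq i)

  level-nonZero : ∀ (p : ZonotopePoint v) → NonZero (level p)
  level-nonZero p = ℕ.>-nonZero (ℕ.≤-<-trans ℕ.z≤n (index<level p))

module _ {n} {v : Vector ℕ n} (v-pos : ∀ i → 0 < v i) where

  -- On the support of p′ the offset of p′ is maximal, so the offsets of p and
  -- p′ cannot differ by a positive multiple of v.
  translate-≤ : ∀ p p′ ρ → Translate p p′ ρ →
    + level p′ ℤ.* + index p ℤ.≤ + level p ℤ.* + index p′ ℤ.+ + level p ℤ.* + level p′ ℤ.* ρ
  translate-≤ p p′ ρ eq = ℤ.≮⇒≥ λ lt →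
    gcdOver-nonempty v (subst (0 <_) (level≡ p′) (ℕ.≤-<-trans ℕ.z≤n (index<level p′))) λ i i∈S′ →
    ℤ.<-irrefl (offset-translate p p′ ρ eq i)
      (ℤ.+-mono-<-≤ (ℤ.*-monoʳ-<-pos (+ v i) {{ℤ.positive (ℤ.+<+ (v-pos i))}} lt) (begin
        + level p′ ℤ.* + offset p i    ≤⟨ ℤ.*-monoˡ-≤-nonNeg (+ level p′) (ℤ.+≤+ (offset≤level p i)) ⟩
        + level p′ ℤ.* + level p       ≡⟨ ℤ.*-comm (+ level p′) (+ level p) ⟩
        + level p ℤ.* + level p′       ≡⟨ cong (λ x → + level p ℤ.* + x) (offset-∈ p′ i∈S′) ⟨
        + level p ℤ.* + offset p′ i    ∎))
    where open ℤ.≤-Reasoning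

  -- `translate-≤` is applied in both directions. The times index / level of the two points
  -- therefore differ by exactly `ρ`.
  translate-index : ∀ p p′ ρ → Translate p p′ ρ →
    + level p′ ℤ.* + index p ≡ + level p ℤ.* + index p′ ℤ.+ + level p ℤ.* + level p′ ℤ.* ρ
  translate-index p p′ ρ eq = ℤ.≤-antisym (translate-≤ p p′ ρ eq)
    (subst (g ℤ.* + index p′ ℤ.+ g ℤ.* g′ ℤ.* ρ ℤ.≤_) (cancel (g′ ℤ.* + index p) g g′ ρ)
      (ℤ.+-monoˡ-≤ (g ℤ.* g′ ℤ.* ρ) (translate-≤ p′ p (ℤ.- ρ) (Translate-sym p p′ ρ eq))))
    where
    g  = + level p
    g′ = + level p′
    cancel : ∀ x g g′ ρ → x ℤ.+ g′ ℤ.* g ℤ.* (ℤ.- ρ) ℤ.+ g ℤ.* g′ ℤ.* ρ ≡ x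
    cancel = ℤ.solve-∀

  -- Both times index / level lie in [0 , 1), so their integer difference `ρ` is 0.
  translate⇒0 : ∀ p p′ ρ → Translate p p′ ρ → ρ ≡ + 0
  translate⇒0 p p′ ρ eq = bounded-multiple
    (subst (level p′ * index p <_) (ℕ.*-comm (level p′) (level p))
      (ℕ.*-monoʳ-< _ {{level-nonZero p′}} (index<level p)))
    (ℕ.*-monoʳ-< _ {{level-nonZero p}} (index<level p′))
    (begin
      + (level p′ * index p)                    ≡⟨ ℤ.pos-* (level p′) (index p) ⟩
      + level p′ ℤ.* + index p                  ≡⟨ translate-index p p′ ρ eq ⟩
      + level p ℤ.* + index p′ ℤ.+ + level p ℤ.* + level p′ ℤ.* ρ
        ≡⟨ cong₂ (λ x y → x ℤ.+ y ℤ.* ρ) (ℤ.pos-* (level p) (index p′)) (ℤ.pos-* (level p) (level p′)) ⟨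
      + (level p * index p′) ℤ.+ + (level p * level p′) ℤ.* ρ ∎)
    where open ≡-Reasoning

  -- The times are equal, hence so are the quotients offset / level, and such a quotient is 1
  -- exactly on the support.
  translate-⊆ : ∀ p p′ → Translate p p′ (+ 0) → support p ⊆ support p′
  translate-⊆ p p′ eq {i} i∈S with i ∈? support p′
  ... | yes i∈S′ = i∈S′
  ... | no  i∉S′ = contradiction (offset-∉ p′ i∉S′) (ℕ.<-irrefl (ℕ.*-cancelˡ-≡ _ _ (level p) {{level-nonZero p}}
    (ℤ.+-injective (begin
      + (level p * offset p′ i)     ≡⟨ ℤ.pos-* (level p) (offset p′ i) ⟩
      + level p ℤ.* + offset p′ i   ≡⟨ ℤ-group.∙-cancelˡ (+ level p′ ℤ.* + index p ℤ.* + v i) _ _ (trans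
        (sym (offset-translate p p′ (+ 0) eq i))
        (cong (λ x → x ℤ.* + v i ℤ.+ + level p′ ℤ.* + offset p i) (sym (translate-index p p′ (+ 0) eq)))) ⟩
      + level p′ ℤ.* + offset p i   ≡⟨ cong (λ x → + level p′ ℤ.* + x) (offset-∈ p i∈S) ⟩
      + level p′ ℤ.* + level p      ≡⟨ ℤ.*-comm (+ level p′) (+ level p) ⟩
      + level p ℤ.* + level p′      ≡⟨ ℤ.pos-* (level p) (level p′) ⟨
      + (level p * level p′)        ∎))))
    where open ≡-Reasoning

  -- Equal supports have equal levels, and then equal times have equal indices.
  translate-injective : ∀ p p′ → Translate p p′ (+ 0) →
                        support p ≡ support p′ × index p ≡ index p′
  translate-injective p p′ eq = S≡S′ , ℕ.*-cancelˡ-≡ _ _ (level p) {{level-nonZero p}}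
    (ℤ.+-injective (begin
      + (level p * index p)       ≡⟨ cong (λ x → + (x * index p)) g≡g′ ⟩
      + (level p′ * index p)      ≡⟨ ℤ.pos-* (level p′) (index p) ⟩
      + level p′ ℤ.* + index p    ≡⟨ translate-index p p′ (+ 0) eq ⟩
      + level p ℤ.* + index p′ ℤ.+ + level p ℤ.* + level p′ ℤ.* + 0
        ≡⟨ cancel (+ level p ℤ.* + index p′) (+ level p ℤ.* + level p′) ⟩
      + level p ℤ.* + index p′    ≡⟨ ℤ.pos-* (level p) (index p′) ⟨
      + (level p * index p′)      ∎))
    where
    open ≡-Reasoning
    S≡S′ : support p ≡ support p′
    S≡S′ = ⊆-antisym (translate-⊆ p p′ eq) (translate-⊆ p′ p (Translate-sym p p′ (+ 0) eq))
    g≡g′ : level p ≡ level p′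
    g≡g′ = trans (level≡ p) (trans (cong (gcdOver v) S≡S′) (sym (level≡ p′)))
    cancel : ∀ x y → x ℤ.+ y ℤ.* + 0 ≡ x
    cancel = ℤ.solve-∀

-- A short vector from the pigeonhole principle

Parallel : ∀ {n} → Vector ℤ n → Vector ℕ n → Set
Parallel z v = ∀ i j → z i ℤ.* + v j ≡ z j ℤ.* + v i

-- Since z 0 v i = z i v 0, the number v 0 divides z 0 v i for every i, hence divides z 0 times the
-- gcd, which is z 0. The quotient is the factor `r` for all coordinates.
parallel-primitive : ∀ {m} (z : Vector ℤ (suc m)) (v : Vector ℕ (suc m)) → (∀ i → 0 < v i) →
                     gcdOver v ⊤ ≡ 1 → Parallel z v → ∃ λ r → ∀ i → z i ≡ r ℤ.* + v i
parallel-primitive z v v-pos gcd≡1 z∥v with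
  ∣ᵤ⇒∣ {+ v zero} {z zero} (subst (v zero ∣_)
    (trans (cong (∣ z zero ∣ *_) gcd≡1) (ℕ.*-identityʳ ∣ z zero ∣))
    (gcdOver-greatest v {⊤} ∣ z zero ∣ λ {i} _ → divides ∣ z i ∣
      (trans (sym (ℤ.abs-* (z zero) (+ v i)))
      (trans (cong ∣_∣ (z∥v zero i)) (ℤ.abs-* (z i) (+ v zero))))))
... | dividesℤ r z₀≡rv₀ = r , λ i → ℤ.*-cancelʳ-≡ (z i) (r ℤ.* + v i) (+ v zero)
  {{ℕ.>-nonZero (v-pos zero)}} (begin
    z i ℤ.* + v zero              ≡⟨ z∥v i zero ⟩
    z zero ℤ.* + v i              ≡⟨ cong (ℤ._* + v i) z₀≡rv₀ ⟩
    r ℤ.* + v zero ℤ.* + v i      ≡⟨ xy∙z≈xz∙y r (+ v zero) (+ v i) ⟩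
    r ℤ.* + v i ℤ.* + v zero      ∎)
  where open ≡-Reasoning

-- The multiple is written out as a difference of quotients because these differences are the
-- entries of the short vector `z`.
mod-≡⇒ : ∀ m m′ d .{{_ : NonZero d}} → m mod d ≡ m′ mod d →
         + m ≡ + m′ ℤ.+ + d ℤ.* (+ (m / d) ℤ.- + (m′ / d))
mod-≡⇒ m m′ d eq = combine-≡ {q = + (m / d)} {+ (m′ / d)} {+ d} (divMod m) (divMod m′) (cong +_ (begin
    m % d          ≡⟨ Fin.toℕ-fromℕ< (m%n<n m d) ⟨
    toℕ (m mod d)  ≡⟨ cong toℕ eq ⟩
    toℕ (m′ mod d) ≡⟨ Fin.toℕ-fromℕ< (m%n<n m′ d) ⟩
    m′ % d         ∎))
  where
  open ≡-Reasoning
  divMod : ∀ x → + x ≡ + (x % d) ℤ.+ + (x / d) ℤ.* + d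
  divMod x = trans (cong +_ (m≡m%n+[m/n]*n x d)) (cong (λ y → + (x % d) ℤ.+ y) (ℤ.pos-* (x / d) d))
  identity : ∀ r q q′ d → r ℤ.+ q ℤ.* d ≡ (r ℤ.+ q′ ℤ.* d) ℤ.+ d ℤ.* (q ℤ.- q′)
  identity = ℤ.solve-∀
  combine-≡ : ∀ {x x′ r r′ q q′ d} → x ≡ r ℤ.+ q ℤ.* d → x′ ≡ r′ ℤ.+ q′ ℤ.* d → r ≡ r′ →
              x ≡ x′ ℤ.+ d ℤ.* (q ℤ.- q′)
  combine-≡ {r = r} {q = q} {q′} {d} refl refl refl = identity r q q′ d

pigeonhole-vector : ∀ {a b c n} → c ^ n < a * b → (f : Fin a × Fin b → Vector (Fin c) n) →
                    ∃₂ λ s s′ → s ≢ s′ × (∀ j → f s j ≡ f s′ j)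
pigeonhole-vector {a} {b} {c} {n} c^n<ab f with Fin.pigeonhole c^n<ab (λ x → funToFin (f (remQuot {a} b x)))
... | x , x′ , x<x′ , eq = remQuot {a} b x , remQuot {a} b x′ ,
  (λ s≡s′ → Fin.<⇒≢ x<x′ (begin
    x                                   ≡⟨ Fin.combine-remQuot {a} b x ⟨
    uncurry combine (remQuot {a} b x)   ≡⟨ cong (uncurry combine) s≡s′ ⟩
    uncurry combine (remQuot {a} b x′)  ≡⟨ Fin.combine-remQuot {a} b x′ ⟩
    x′                                  ∎)) ,
  λ j → begin
    f (remQuot {a} b x) j                       ≡⟨ Fin.finToFun-funToFin (f (remQuot {a} b x)) j ⟨
    finToFun (funToFin (f (remQuot {a} b x))) j ≡⟨ cong (λ r → finToFun r j) eq ⟩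
    finToFun (funToFin (f (remQuot {a} b x′))) j ≡⟨ Fin.finToFun-funToFin (f (remQuot {a} b x′)) j ⟩
    f (remQuot {a} b x′) j                      ∎
  where open ≡-Reasoning

-- Counting the translates coord + k v with k < N, instead of classes modulo v,
-- avoids choosing a basis of ℤⁿ / ℤ v.
module Collision {m} (v : Vector ℕ (suc m)) (v-pos : ∀ i → 0 < v i) (gcd≡1 : gcdOver v ⊤ ≡ 1)
                 (N : ℕ) .{{_ : NonZero N}} (N^m<∑gcd : N ^ m < ∑gcd v) where

  points : List (Subset (suc m) × ℕ)
  points = pairsBelow (gcdOver v) (subsets (suc m))

  point-spec : ∀ i → ∃ λ (p : ZonotopePoint v) →
    support p ≡ proj₁ (lookup points i) × index p ≡ proj₂ (lookup points i)
  point-spec i = zonotopePoint v (proj₁ (lookup points i))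
    (All.lookup (pairsBelow-< (gcdOver v) (subsets (suc m))) (∈-lookup i))

  point : Fin (length points) → ZonotopePoint v
  point i = proj₁ (point-spec i)

  point-injective : ∀ {i j} → support (point i) ≡ support (point j) × index (point i) ≡ index (point j) → i ≡ j
  point-injective {i} {j} (S≡ , a≡) with point-spec i | point-spec j
  ... | _ , refl , refl | _ , refl , refl = lookup-injective
    (pairsBelow-unique (gcdOver v) (subsets-unique (suc m))) (cong₂ _,_ S≡ a≡)

  shifted : Fin (length points) × Fin N → Vector ℕ (suc m)
  shifted (i , k) j = coord (point i) j + toℕ k * v j

  collision : ∃₂ λ s s′ → s ≢ s′ × (∀ j → shifted s j mod N ≡ shifted s′ j mod N)
  collision = pigeonhole-vector
    -- The hypothesis times `N`: each of the ∑ v_S points has `N` translates, against `N ^ suc m`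
    -- classes modulo `N`.
    (subst (N ^ suc m <_)
      (trans (ℕ.*-comm N _) (cong (_* N) (sym (length-pairsBelow (gcdOver v) (subsets (suc m))))))
      (ℕ.*-monoʳ-< N N^m<∑gcd))
    λ s j → shifted s j mod N

  i i′ : Fin (length points)
  i  = proj₁ (proj₁ collision)
  i′ = proj₁ (proj₁ (proj₂ collision))
  k k′ : Fin N
  k  = proj₂ (proj₁ collision)
  k′ = proj₂ (proj₁ (proj₂ collision))
  p p′ : ZonotopePoint v
  p  = point i
  p′ = point i′

  z : Vector ℤ (suc m)
  z j = + (shifted (i , k) j / N) ℤ.- + (shifted (i′ , k′) j / N)

  coord-z : ∀ j → + coord p j ≡ + coord p′ j ℤ.+ (+ toℕ k′ ℤ.- + toℕ k) ℤ.* + v j ℤ.+ + N ℤ.* z j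
  coord-z j = isolate (+ coord p j) (+ coord p′ j) (+ toℕ k) (+ toℕ k′) (+ v j) (+ N ℤ.* z j) (begin
    + coord p j ℤ.+ + toℕ k ℤ.* + v j                   ≡⟨ cong (λ x → + coord p j ℤ.+ x) (ℤ.pos-* (toℕ k) (v j)) ⟨
    + shifted (i , k) j                                 ≡⟨ mod-≡⇒ (shifted (i , k) j) (shifted (i′ , k′) j) N
                                                             (proj₂ (proj₂ (proj₂ collision)) j) ⟩
    + shifted (i′ , k′) j ℤ.+ + N ℤ.* z j               ≡⟨ cong (λ x → + coord p′ j ℤ.+ x ℤ.+ + N ℤ.* z j)
                                                             (ℤ.pos-* (toℕ k′) (v j)) ⟩
    + coord p′ j ℤ.+ + toℕ k′ ℤ.* + v j ℤ.+ + N ℤ.* z j ∎)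
    where
    open ≡-Reasoning
    cancel : ∀ y x → y ≡ y ℤ.+ x ℤ.- x
    cancel = ℤ.solve-∀
    collect : ∀ y′ k k′ v x → y′ ℤ.+ k′ ℤ.* v ℤ.+ x ℤ.- k ℤ.* v ≡ y′ ℤ.+ (k′ ℤ.- k) ℤ.* v ℤ.+ x
    collect = ℤ.solve-∀
    isolate : ∀ y y′ k k′ v x → y ℤ.+ k ℤ.* v ≡ y′ ℤ.+ k′ ℤ.* v ℤ.+ x →
              y ≡ y′ ℤ.+ (k′ ℤ.- k) ℤ.* v ℤ.+ x
    isolate y y′ k k′ v x eq =
      trans (cancel y (k ℤ.* v)) (trans (cong (ℤ._- k ℤ.* v) eq) (collect y′ k k′ v x))

  -- If z = r v, the two points are translates by k′ - k + N r. This number must then be 0 and the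
  -- points equal; moreover k and k′ agree modulo `N` and are below `N`, so the colliding pairs
  -- would coincide.
  z-not-parallel : ¬ Parallel z v
  z-not-parallel z∥v = proj₁ (proj₂ (proj₂ collision)) (cong₂ _,_ i≡i′ k≡k′)
    where
    r = proj₁ (parallel-primitive z v v-pos gcd≡1 z∥v)
    ρ = + toℕ k′ ℤ.- + toℕ k ℤ.+ + N ℤ.* r

    translate : Translate p p′ ρ
    translate j = begin
      + coord p j
        ≡⟨ coord-z j ⟩
      + coord p′ j ℤ.+ (+ toℕ k′ ℤ.- + toℕ k) ℤ.* + v j ℤ.+ + N ℤ.* z j
        ≡⟨ cong (λ x → + coord p′ j ℤ.+ (+ toℕ k′ ℤ.- + toℕ k) ℤ.* + v j ℤ.+ + N ℤ.* x)
             (proj₂ (parallel-primitive z v v-pos gcd≡1 z∥v) j) ⟩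
      + coord p′ j ℤ.+ (+ toℕ k′ ℤ.- + toℕ k) ℤ.* + v j ℤ.+ + N ℤ.* (r ℤ.* + v j)
        ≡⟨ collect (+ coord p′ j) (+ toℕ k′ ℤ.- + toℕ k) (+ v j) (+ N) r ⟩
      + coord p′ j ℤ.+ ρ ℤ.* + v j ∎
      where
      open ≡-Reasoning
      collect : ∀ y x v N r → y ℤ.+ x ℤ.* v ℤ.+ N ℤ.* (r ℤ.* v) ≡ y ℤ.+ (x ℤ.+ N ℤ.* r) ℤ.* v
      collect = ℤ.solve-∀

    ρ≡0 : ρ ≡ + 0
    ρ≡0 = translate⇒0 v-pos p p′ ρ translate

    i≡i′ : i ≡ i′
    i≡i′ = point-injective (translate-injective v-pos p p′ (subst (Translate p p′) ρ≡0 translate))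

    k≡k′+Nr : + toℕ k ≡ + toℕ k′ ℤ.+ + N ℤ.* r
    k≡k′+Nr = solve (+ toℕ k) (+ toℕ k′) (+ N ℤ.* r) ρ≡0
      where
      identity : ∀ k k′ x → k′ ℤ.+ x ≡ k′ ℤ.- k ℤ.+ x ℤ.+ k
      identity = ℤ.solve-∀
      solve : ∀ k k′ x → k′ ℤ.- k ℤ.+ x ≡ + 0 → k ≡ k′ ℤ.+ x
      solve k k′ x eq = sym (trans (identity k k′ x) (trans (cong (ℤ._+ k) eq) (ℤ.+-identityˡ k)))

    k≡k′ : k ≡ k′
    k≡k′ = Fin.toℕ-injective (ℤ.+-injective (trans k≡k′+Nr
      (trans (cong (λ x → + toℕ k′ ℤ.+ + N ℤ.* x) (bounded-multiple (Fin.toℕ<n k) (Fin.toℕ<n k′) k≡k′+Nr))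
      (trans (cong (λ x → + toℕ k′ ℤ.+ x) (ℤ.*-zeroʳ (+ N))) (ℤ.+-identityʳ (+ toℕ k′))))))

  G : ℕ
  G = level p * level p′

  -- K / G is the difference of the times index / level + k of the two shifted points.
  K : ℤ
  K = + level p′ ℤ.* + index p ℤ.- + level p ℤ.* + index p′
      ℤ.+ + level p ℤ.* + level p′ ℤ.* (+ toℕ k ℤ.- + toℕ k′)

  -- A shifted point is its time multiplied by v, plus 1, minus offset / level. Subtracting two of
  -- them leaves N z - (K / G) v as a difference of two numbers in [0 , 1].
  z-close : ∀ j → ∣ + (G * N) ℤ.* z j ℤ.- K ℤ.* + v j ∣ ≤ G
  z-close j = subst (λ x → ∣ x ∣ ≤ G) (sym (trans
      (cong (λ x → x ℤ.* z j ℤ.- K ℤ.* + v j) (trans (ℤ.pos-* G N) (cong (ℤ._* + N) (ℤ.pos-* (level p) (level p′)))))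
      (trans (identity {+ level p} {+ index p} {+ level p′} {+ index p′} {+ coord p j} {+ coord p′ j} {+ toℕ k} {+ toℕ k′} {+ N} {z j} {+ v j}
                 (offset≡ p j) (offset≡ p′ j) (coord-z j))
             (sym (cong₂ ℤ._-_ (ℤ.pos-* (level p) (offset p′ j)) (ℤ.pos-* (level p′) (offset p j)))))))
    (∣m-n∣≤o (ℕ.*-monoʳ-≤ (level p) (offset≤level p′ j))
      (subst (level p′ * offset p j ≤_) (ℕ.*-comm (level p′) (level p)) (ℕ.*-monoʳ-≤ (level p′) (offset≤level p j))))
    where
    identity : ∀ {g a g′ a′ y y′ k k′ N z v r r′ : ℤ} →
      r ≡ a ℤ.* v ℤ.+ g ℤ.- y ℤ.* g → r′ ≡ a′ ℤ.* v ℤ.+ g′ ℤ.- y′ ℤ.* g′ →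
      y ≡ y′ ℤ.+ (k′ ℤ.- k) ℤ.* v ℤ.+ N ℤ.* z →
      g ℤ.* g′ ℤ.* N ℤ.* z ℤ.- (g′ ℤ.* a ℤ.- g ℤ.* a′ ℤ.+ g ℤ.* g′ ℤ.* (k ℤ.- k′)) ℤ.* v
      ≡ g ℤ.* r′ ℤ.- g′ ℤ.* r
    identity {g} {a} {g′} {a′} {_} {y′} {k} {k′} {N} {z} {v} refl refl refl =
      ring g a g′ a′ y′ k k′ N z v
      where
      ring : ∀ g a g′ a′ y′ k k′ N z v →
        g ℤ.* g′ ℤ.* N ℤ.* z ℤ.- (g′ ℤ.* a ℤ.- g ℤ.* a′ ℤ.+ g ℤ.* g′ ℤ.* (k ℤ.- k′)) ℤ.* v
        ≡ g ℤ.* (a′ ℤ.* v ℤ.+ g′ ℤ.- y′ ℤ.* g′)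
          ℤ.- g′ ℤ.* (a ℤ.* v ℤ.+ g ℤ.- (y′ ℤ.+ (k′ ℤ.- k) ℤ.* v ℤ.+ N ℤ.* z) ℤ.* g)
      ring = ℤ.solve-∀

-- | z - τ v | ≤ 1 / N for τ = K / (G N), with denominators cleared.
ShortVector : ∀ {n} → Vector ℕ n → ℕ → Set
ShortVector v N = ∃ λ z → ¬ Parallel z v ×
  ∃₂ λ G K → 0 < G × (∀ j → ∣ + (G * N) ℤ.* z j ℤ.- K ℤ.* + v j ∣ ≤ G)

short-vector : ∀ {m} (v : Vector ℕ (suc m)) → (∀ i → 0 < v i) → gcdOver v ⊤ ≡ 1 →
  ∀ N .{{_ : NonZero N}} → N ^ m < ∑gcd v → ShortVector v N
short-vector v v-pos gcd≡1 N N^m<∑gcd = z , z-not-parallel , G , K ,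
  ℕ.*-mono-≤ (ℕ.≤-<-trans ℕ.z≤n (index<level p)) (ℕ.≤-<-trans ℕ.z≤n (index<level p′)) , z-close
  where open Collision v v-pos gcd≡1 N N^m<∑gcd

-- Adjacent slopes

module Slopes {n} (z : Vector ℤ n) (v : Vector ℕ n) (v-pos : ∀ i → 0 < v i) where

  infix 4 _≺_

  -- Comparison of the slopes z i / v i and z j / v j with denominators cleared. Distinct indices
  -- may share a slope, so this is only a strict partial order.
  _≺_ : Fin n → Fin n → Set
  i ≺ j = z i ℤ.* + v j ℤ.< z j ℤ.* + v i

  -- mediant i j k vanishes iff the slope z k / v k is the mediant of the slopes
  -- of i and j; it lies strictly between them, so it is never a slope when i and
  -- j have adjacent slopes.
  mediant : Fin n → Fin n → Fin n → ℤ
  mediant i j k = + v k ℤ.* (z i ℤ.+ z j) ℤ.- z k ℤ.* (+ v i ℤ.+ + v j)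

  -- At `i` and `j` only the cross terms z i v j and z j v i survive. This makes two of the
  -- velocities opposite, so that one can be spared.
  mediant-antisym : ∀ i j → mediant i j j ≡ ℤ.- mediant i j i
  mediant-antisym i j = ring (z i) (z j) (+ v i) (+ v j)
    where
    ring : ∀ zᵢ zⱼ vᵢ vⱼ → vⱼ ℤ.* (zᵢ ℤ.+ zⱼ) ℤ.- zⱼ ℤ.* (vᵢ ℤ.+ vⱼ)
           ≡ ℤ.- (vᵢ ℤ.* (zᵢ ℤ.+ zⱼ) ℤ.- zᵢ ℤ.* (vᵢ ℤ.+ vⱼ))
    ring = ℤ.solve-∀

  private instance
    v-positive : ∀ {i} → ℤ.Positive (+ v i)
    v-positive {i} = ℤ.positive (ℤ.+<+ (v-pos i))

  ≺-irrefl : ∀ {i j} → i ≡ j → ¬ i ≺ j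
  ≺-irrefl refl = ℤ.<-irrefl refl

  ≺-trans : ∀ {i j k} → i ≺ j → j ≺ k → i ≺ k
  ≺-trans {i} {j} {k} i≺j j≺k = ℤ.*-cancelʳ-<-nonNeg (+ v j) (begin-strict
    z i ℤ.* + v k ℤ.* + v j  ≡⟨ xy∙z≈xz∙y (z i) (+ v k) (+ v j) ⟩
    z i ℤ.* + v j ℤ.* + v k  <⟨ ℤ.*-monoʳ-<-pos (+ v k) i≺j ⟩
    z j ℤ.* + v i ℤ.* + v k  ≡⟨ xy∙z≈xz∙y (z j) (+ v i) (+ v k) ⟩
    z j ℤ.* + v k ℤ.* + v i  <⟨ ℤ.*-monoʳ-<-pos (+ v i) j≺k ⟩
    z k ℤ.* + v j ℤ.* + v i  ≡⟨ xy∙z≈xz∙y (z k) (+ v j) (+ v i) ⟩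
    z k ℤ.* + v i ℤ.* + v j  ∎)
    where open ℤ.≤-Reasoning

  ≺-wellFounded : WellFounded _≺_
  ≺-wellFounded = spo-wellFounded {_≈_ = _≡_} record
    { isEquivalence = isEquivalence
    ; irrefl        = ≺-irrefl
    ; trans         = λ {i j k} → ≺-trans {i} {j} {k}
    ; <-resp-≈      = resp₂ _≺_
    }

  ∃≺ : ¬ Parallel z v → ∃₂ λ i j → i ≺ j
  ∃≺ z∦v with Fin.any? (λ i → Fin.any? λ j → z i ℤ.* + v j ℤ.<? z j ℤ.* + v i)
  ... | yes (i , j , i≺j) = i , j , i≺j
  ... | no  ⊀ = contradiction
    (λ i j → ℤ.≤-antisym (ℤ.≮⇒≥ λ j≺i → ⊀ (j , i , j≺i)) (ℤ.≮⇒≥ λ i≺j → ⊀ (i , j , i≺j))) z∦v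

  -- Starting from `j`, move to any index strictly between as long as there is one; well-foundedness
  -- ends the descent.
  ∃-adjacent : ∀ {i j} → i ≺ j → ∃ λ k → i ≺ k × (∀ l → i ≺ l → ¬ l ≺ k)
  ∃-adjacent {i} {j} i≺j = descend j (≺-wellFounded j) i≺j
    where
    descend : ∀ j → Acc _≺_ j → i ≺ j → ∃ λ k → i ≺ k × (∀ l → i ≺ l → ¬ l ≺ k)
    descend j (acc rs) i≺j with Fin.any? (λ l →
      (z i ℤ.* + v l ℤ.<? z l ℤ.* + v i) ×-dec (z l ℤ.* + v j ℤ.<? z j ℤ.* + v l))
    ... | yes (l , i≺l , l≺j) = descend l (rs l≺j) i≺l
    ... | no  none = j , i≺j , λ l i≺l l≺j → none (l , i≺l , l≺j)

  -- The mediant inequality. Each comparison is multiplied by v i + v j; exchanging z k (v i + v j)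
  -- for v k (z i + z j) by `balance` reduces it to a positive multiple of i ≺ j.
  mediant-between : ∀ {i j} k → i ≺ j → mediant i j k ≡ + 0 → i ≺ k × k ≺ j
  mediant-between {i} {j} k i≺j u≡0 =
    ℤ.*-cancelʳ-<-nonNeg (+ v i ℤ.+ + v j) (begin-strict
      z i ℤ.* + v k ℤ.* (+ v i ℤ.+ + v j)
        ≡⟨ ring₁ (z i) (+ v k) (+ v i) (+ v j) ⟩
      + v k ℤ.* (z i ℤ.* + v i ℤ.+ z i ℤ.* + v j)
        <⟨ ℤ.*-monoˡ-<-pos (+ v k) (ℤ.+-monoʳ-< (z i ℤ.* + v i) i≺j) ⟩
      + v k ℤ.* (z i ℤ.* + v i ℤ.+ z j ℤ.* + v i)
        ≡⟨ ring₂ (+ v k) (z i) (z j) (+ v i) ⟩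
      + v k ℤ.* (z i ℤ.+ z j) ℤ.* + v i
        ≡⟨ cong (ℤ._* + v i) balance ⟩
      z k ℤ.* (+ v i ℤ.+ + v j) ℤ.* + v i
        ≡⟨ xy∙z≈xz∙y (z k) (+ v i ℤ.+ + v j) (+ v i) ⟩
      z k ℤ.* + v i ℤ.* (+ v i ℤ.+ + v j) ∎) ,
    ℤ.*-cancelʳ-<-nonNeg (+ v i ℤ.+ + v j) (begin-strict
      z k ℤ.* + v j ℤ.* (+ v i ℤ.+ + v j)
        ≡⟨ xy∙z≈xz∙y (z k) (+ v j) (+ v i ℤ.+ + v j) ⟩
      z k ℤ.* (+ v i ℤ.+ + v j) ℤ.* + v j
        ≡⟨ cong (ℤ._* + v j) balance ⟨
      + v k ℤ.* (z i ℤ.+ z j) ℤ.* + v j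
        ≡⟨ ring₂ (+ v k) (z i) (z j) (+ v j) ⟨
      + v k ℤ.* (z i ℤ.* + v j ℤ.+ z j ℤ.* + v j)
        <⟨ ℤ.*-monoˡ-<-pos (+ v k) (ℤ.+-monoˡ-< (z j ℤ.* + v j) i≺j) ⟩
      + v k ℤ.* (z j ℤ.* + v i ℤ.+ z j ℤ.* + v j)
        ≡⟨ ring₁ (z j) (+ v k) (+ v i) (+ v j) ⟨
      z j ℤ.* + v k ℤ.* (+ v i ℤ.+ + v j) ∎)
    where
    open ℤ.≤-Reasoning
    balance : + v k ℤ.* (z i ℤ.+ z j) ≡ z k ℤ.* (+ v i ℤ.+ + v j)
    balance = ℤ.i-j≡0⇒i≡j _ _ u≡0
    ring₁ : ∀ z w x y → z ℤ.* w ℤ.* (x ℤ.+ y) ≡ w ℤ.* (z ℤ.* x ℤ.+ z ℤ.* y)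
    ring₁ = ℤ.solve-∀
    ring₂ : ∀ w x y v → w ℤ.* (x ℤ.* v ℤ.+ y ℤ.* v) ≡ w ℤ.* (x ℤ.+ y) ℤ.* v
    ring₂ = ℤ.solve-∀

  ∃-mediant≢0 : ¬ Parallel z v → ∃₂ λ i j → i ≢ j × (∀ k → mediant i j k ≢ + 0)
  ∃-mediant≢0 z∦v =
    let i , _ , i≺j     = ∃≺ z∦v
        j , i≺j , empty = ∃-adjacent i≺j
    in i , j , (λ i≡j → ≺-irrefl i≡j i≺j) ,
       λ k u≡0 → uncurry (empty k) (mediant-between k i≺j u≡0)

-- Fractions far from the integers

-- ‖ x / d ‖ ≥ 1 / c, in units of 1 / d.
Far : ℕ → ℤ → ℕ → Set
Far c x d = ∀ l → d ≤ c * ∣ x ℤ.- l ℤ.* + d ∣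

FarTime : ∀ {n} → ℕ → Vector ℤ n → Set
FarTime c u = ∃₂ λ a d → 0 < d × ∀ k → Far c (u k ℤ.* a) d

Far-neg : ∀ {c x d} → Far c x d → Far c (ℤ.- x) d
Far-neg {c} {x} {d} far l = subst (λ a → d ≤ c * a)
  (trans (sym (ℤ.∣-i∣≡∣i∣ (x ℤ.- ℤ.- l ℤ.* + d))) (cong ∣_∣ (ring x l (+ d)))) (far (ℤ.- l))
  where
  ring : ∀ x l d → ℤ.- (x ℤ.- ℤ.- l ℤ.* d) ≡ ℤ.- x ℤ.- l ℤ.* d
  ring = ℤ.solve-∀

Far-abs : ∀ {c} u a {d} → Far c (+ ∣ u ∣ ℤ.* a) d → Far c (u ℤ.* a) d
Far-abs {c} u a {d} far with ℤ.+∣i∣≡i⊎+∣i∣≡-i u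
... | inj₁ eq = subst (λ x → Far c (x ℤ.* a) d) eq far
... | inj₂ eq = subst (λ x → Far c x d) (ring u a) (Far-neg {c} {ℤ.- u ℤ.* a} (subst (λ x → Far c (x ℤ.* a) d) eq far))
  where
  ring : ∀ u a → ℤ.- (ℤ.- u ℤ.* a) ≡ u ℤ.* a
  ring = ℤ.solve-∀

nearest : ∀ x d .{{_ : NonZero d}} → ∃ λ h → 2 * ∣ x ℤ.- h ℤ.* + d ∣ ≤ d
nearest x d with ℕ.≤-total (2 * (x ℤ.%ℕ d)) d
... | inj₁ 2r≤d = x ℤ./ℕ d , subst (λ a → 2 * ∣ a ∣ ≤ d) (remainder {r = + (x ℤ.%ℕ d)} {x ℤ./ℕ d ℤ.* + d} (ℤ.a≡a%ℕn+[a/ℕn]*n x d)) 2r≤d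
  where
  cancel : ∀ r y → r ≡ r ℤ.+ y ℤ.- y
  cancel = ℤ.solve-∀
  remainder : ∀ {x r y} → x ≡ r ℤ.+ y → r ≡ x ℤ.- y
  remainder {r = r} {y} refl = cancel r y
... | inj₂ d≤2r = ℤ.suc (x ℤ./ℕ d) , subst (λ a → 2 * a ≤ d)
  (trans (ℤ.∣i-j∣≡∣j-i∣ (+ d) (+ r)) (cong ∣_∣ (remainder {r = + r} {x ℤ./ℕ d} {+ d} (ℤ.a≡a%ℕn+[a/ℕn]*n x d)))) (begin
    2 * ∣ + d ℤ.- + r ∣    ≡⟨ cong (λ a → 2 * ∣ a ∣) (trans (ℤ.m-n≡m⊖n d r) (ℤ.⊖-≥ r≤d)) ⟩
    2 * (d ℕ.∸ r)          ≡⟨ ℕ.*-distribˡ-∸ 2 d r ⟩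
    2 * d ℕ.∸ 2 * r        ≤⟨ ℕ.∸-monoʳ-≤ (2 * d) d≤2r ⟩
    2 * d ℕ.∸ d            ≡⟨ ℕ.m+n∸m≡n d (d + 0) ⟩
    d + 0                  ≡⟨ ℕ.+-identityʳ d ⟩
    d                      ∎)
  where
  open ℕ.≤-Reasoning
  r = x ℤ.%ℕ d
  r≤d : r ≤ d
  r≤d = ℕ.<⇒≤ (ℤ.n%ℕd<d x d)
  shift : ∀ r q d → r ℤ.- d ≡ r ℤ.+ q ℤ.* d ℤ.- (+ 1 ℤ.+ q) ℤ.* d
  shift = ℤ.solve-∀
  remainder : ∀ {x r q d} → x ≡ r ℤ.+ q ℤ.* d → r ℤ.- d ≡ x ℤ.- ℤ.suc q ℤ.* d
  remainder {r = r} {q} {d} refl = shift r q d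

∣a∣≤∣a+b∣+∣b∣ : ∀ a b → ∣ a ∣ ≤ ∣ a ℤ.+ b ∣ + ∣ b ∣
∣a∣≤∣a+b∣+∣b∣ a b = subst (λ x → ∣ x ∣ ≤ ∣ a ℤ.+ b ∣ + ∣ b ∣) (cancel a b) (ℤ.∣i-j∣≤∣i∣+∣j∣ (a ℤ.+ b) b)
  where
  cancel : ∀ a b → a ℤ.+ b ℤ.- b ≡ a
  cancel = ℤ.solve-∀

-- A time A / D for the velocities u k = v k c - z k e becomes the time
-- c A / D - τ (e A / D - h), τ = K / (G N), for the velocities v k: modulo
-- integers the position changes by (e A / D - h) (z k - τ v k), which is at
-- most 1 / (2 N) = 1 / n - 1 / (n + 1).
lift-time : ∀ {n N G D : ℕ} {A K c e h : ℤ} → 0 < n → 2 * N ≡ n * suc n →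
  2 * ∣ e ℤ.* A ℤ.- h ℤ.* + D ∣ ≤ D → ∀ z v →
  ∣ + (G * N) ℤ.* z ℤ.- K ℤ.* v ∣ ≤ G →
  Far n ((v ℤ.* c ℤ.- z ℤ.* e) ℤ.* A) D →
  Far (suc n) (v ℤ.* (c ℤ.* A ℤ.* + (G * N) ℤ.- K ℤ.* (e ℤ.* A ℤ.- h ℤ.* + D))) (G * N * D)
lift-time {n} {N} {G} {D} {A} {K} {c} {e} {h} 0<n 2N≡n[n+1] h-near z v z-close far l =
  -- After multiplying by `n`, the term `G * N * D` on both sides is the allowance 1 / (2 N): n + 1
  -- copies of it come from the bound 1 / n, and one of them pays for the change of position.
  ℕ.*-cancelˡ-≤ n {{ℕ.>-nonZero 0<n}} (ℕ.+-cancelʳ-≤ (G * N * D) _ _ (begin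
    n * (G * N * D) + G * N * D    ≡⟨ nat₁ n (G * N) D ⟩
    suc n * (G * N) * D            ≤⟨ ℕ.*-monoʳ-≤ (suc n * (G * N)) (far (l ℤ.- h ℤ.* z)) ⟩
    suc n * (G * N) * (n * ∣ x ∣)  ≡⟨ nat₂ n (G * N) ∣ x ∣ ⟩
    n * suc n * (G * N * ∣ x ∣)    ≡⟨ cong (n * suc n *_) (ℤ.abs-* (+ (G * N)) x) ⟨
    n * suc n * ∣ GN ℤ.* x ∣       ≤⟨ ℕ.*-monoʳ-≤ (n * suc n) (∣a∣≤∣a+b∣+∣b∣ (GN ℤ.* x) (y ℤ.* w)) ⟩
    n * suc n * (∣ GN ℤ.* x ℤ.+ y ℤ.* w ∣ + ∣ y ℤ.* w ∣)
      ≡⟨ cong₂ (λ s t → n * suc n * (s + t)) (cong ∣_∣ position) (ℤ.abs-* y w) ⟩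
    n * suc n * (s + ∣ y ∣ * ∣ w ∣)
      ≡⟨ ℕ.*-distribˡ-+ (n * suc n) s (∣ y ∣ * ∣ w ∣) ⟩
    n * suc n * s + n * suc n * (∣ y ∣ * ∣ w ∣)
      ≡⟨ cong₂ _+_ (ℕ.*-assoc n (suc n) s) (cong (_* (∣ y ∣ * ∣ w ∣)) (sym 2N≡n[n+1])) ⟩
    n * (suc n * s) + 2 * N * (∣ y ∣ * ∣ w ∣)
      ≡⟨ cong (n * (suc n * s) ℕ.+_) (nat₃ N ∣ y ∣ ∣ w ∣) ⟩
    n * (suc n * s) + N * (2 * ∣ y ∣ * ∣ w ∣)
      ≤⟨ ℕ.+-monoʳ-≤ (n * (suc n * s)) (ℕ.*-monoʳ-≤ N (ℕ.*-mono-≤ h-near z-close)) ⟩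
    n * (suc n * s) + N * (D * G)
      ≡⟨ cong (n * (suc n * s) ℕ.+_) (nat₄ N D G) ⟩
    n * (suc n * s) + G * N * D ∎))
  where
  open ℕ.≤-Reasoning
  GN = + (G * N)
  -- The change of position includes the integer h z, so distance to l for the velocity v is
  -- compared with distance to l - h z for u.
  x  = (v ℤ.* c ℤ.- z ℤ.* e) ℤ.* A ℤ.- (l ℤ.- h ℤ.* z) ℤ.* + D
  y  = e ℤ.* A ℤ.- h ℤ.* + D
  w  = GN ℤ.* z ℤ.- K ℤ.* v
  s  = ∣ v ℤ.* (c ℤ.* A ℤ.* GN ℤ.- K ℤ.* y) ℤ.- l ℤ.* + (G * N * D) ∣
  ring : ∀ v c z e A l h d gn K →
    gn ℤ.* ((v ℤ.* c ℤ.- z ℤ.* e) ℤ.* A ℤ.- (l ℤ.- h ℤ.* z) ℤ.* d)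
      ℤ.+ (e ℤ.* A ℤ.- h ℤ.* d) ℤ.* (gn ℤ.* z ℤ.- K ℤ.* v)
    ≡ v ℤ.* (c ℤ.* A ℤ.* gn ℤ.- K ℤ.* (e ℤ.* A ℤ.- h ℤ.* d)) ℤ.- l ℤ.* (gn ℤ.* d)
  ring = ℤ.solve-∀
  position : GN ℤ.* x ℤ.+ y ℤ.* w ≡ v ℤ.* (c ℤ.* A ℤ.* GN ℤ.- K ℤ.* y) ℤ.- l ℤ.* + (G * N * D)
  position = trans (ring v c z e A l h (+ D) GN K)
    (cong (λ q → v ℤ.* (c ℤ.* A ℤ.* GN ℤ.- K ℤ.* y) ℤ.- l ℤ.* q) (sym (ℤ.pos-* (G * N) D)))
  nat₁ : ∀ n a d → n * (a * d) + a * d ≡ suc n * a * d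
  nat₁ = ℕ.solve-∀
  nat₂ : ∀ n a x → suc n * a * (n * x) ≡ n * suc n * (a * x)
  nat₂ = ℕ.solve-∀
  nat₃ : ∀ N y w → 2 * N * (y * w) ≡ N * (2 * y * w)
  nat₃ = ℕ.solve-∀
  nat₄ : ∀ N d g → N * (d * g) ≡ g * N * d
  nat₄ = ℕ.solve-∀

-- Rational times

toℚᵘ-/ : ∀ k d-1 → toℚᵘ (k ℚ./ suc d-1) ℚᵘ.≃ ℚᵘ.mkℚᵘ k d-1
toℚᵘ-/ k d-1 = ℚ.toℚᵘ-fromℚᵘ (ℚᵘ.mkℚᵘ k d-1)

-- Unnormalised fractions expose the numerator of the distance. Since `x` is tied to p / d only up
-- to equivalence, p / d may fail to be in lowest terms.
toℚᵘ-distance : ∀ w l {x p d-1} → toℚᵘ x ℚᵘ.≃ ℚᵘ.mkℚᵘ p d-1 →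
  toℚᵘ ℚ.∣ w ℚ./ 1 ℚ.* x ℚ.- l ℚ./ 1 ∣ ℚᵘ.≃
  ℚᵘ.mkℚᵘ (+ ∣ w ℤ.* p ℤ.- l ℤ.* + suc d-1 ∣) d-1
toℚᵘ-distance w l {x} {p} {d-1} x≃p/d = begin
  toℚᵘ ℚ.∣ w ℚ./ 1 ℚ.* x ℚ.- l ℚ./ 1 ∣
    ≈⟨ ℚ.toℚᵘ-homo-∣-∣ (w ℚ./ 1 ℚ.* x ℚ.- l ℚ./ 1) ⟩
  ℚᵘ.∣ toℚᵘ (w ℚ./ 1 ℚ.* x ℚ.- l ℚ./ 1) ∣
    ≈⟨ ℚᵘ.∣-∣-cong (ℚ.toℚᵘ-homo-+ (w ℚ./ 1 ℚ.* x) (ℚ.- (l ℚ./ 1))) ⟩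
  ℚᵘ.∣ toℚᵘ (w ℚ./ 1 ℚ.* x) ℚᵘ.+ toℚᵘ (ℚ.- (l ℚ./ 1)) ∣
    ≈⟨ ℚᵘ.∣-∣-cong (ℚᵘ.+-cong
         (ℚᵘ.≃-trans (ℚ.toℚᵘ-homo-* (w ℚ./ 1) x) (ℚᵘ.*-cong (toℚᵘ-/ w 0) x≃p/d))
         (ℚᵘ.≃-trans (ℚ.toℚᵘ-homo‿- (l ℚ./ 1)) (ℚᵘ.-‿cong (toℚᵘ-/ l 0)))) ⟩
  ℚᵘ.∣ ℚᵘ.mkℚᵘ w 0 ℚᵘ.* ℚᵘ.mkℚᵘ p d-1 ℚᵘ.+ ℚᵘ.- ℚᵘ.mkℚᵘ l 0 ∣
    ≈⟨ ℚᵘ.*≡* (cong₂ (λ a b → + ∣ a ∣ ℤ.* b)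
         (trans (cong (λ d → w ℤ.* p ℤ.* + 1 ℤ.+ ℤ.- l ℤ.* + d) (ℕ.*-identityˡ (suc d-1))) (ring (w ℤ.* p) l (+ suc d-1)))
         (cong +_ (sym (trans (ℕ.*-identityʳ (1 * suc d-1)) (ℕ.*-identityˡ (suc d-1)))))) ⟩
  ℚᵘ.mkℚᵘ (+ ∣ w ℤ.* p ℤ.- l ℤ.* + suc d-1 ∣) d-1 ∎
  where
  open ℚᵘ.≃-Reasoning
  ring : ∀ a l d → a ℤ.* + 1 ℤ.+ ℤ.- l ℤ.* d ≡ a ℤ.- l ℤ.* d
  ring = ℤ.solve-∀

-- Only the integer at which the distance is attained has to be tested; the converse below uses that
-- the distance is minimal over all integers.
Far⇒≤‖‖ : ∀ m w p {d-1 x} → toℚᵘ x ℚᵘ.≃ ℚᵘ.mkℚᵘ p d-1 → Far (suc m) (w ℤ.* p) (suc d-1) →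
          + 1 ℚ./ suc m ℚ.≤ ‖ w ℚ./ 1 ℚ.* x ‖ℚ
Far⇒≤‖‖ m w p {d-1} {x} x≃p/d far with ‖‖ℚ-attained (w ℚ./ 1 ℚ.* x)
... | l , eq = subst (+ 1 ℚ./ suc m ℚ.≤_) (sym eq) (ℚ.toℚᵘ-cancel-≤
  (ℚᵘ.≤-respˡ-≃ (ℚᵘ.≃-sym (toℚᵘ-/ (+ 1) m))
  (ℚᵘ.≤-respʳ-≃ (ℚᵘ.≃-sym (toℚᵘ-distance w l x≃p/d))
  (ℚᵘ.*≤* (subst₂ ℤ._≤_ (sym (ℤ.*-identityˡ (+ suc d-1)))
    (trans (cong +_ (ℕ.*-comm (suc m) a)) (ℤ.pos-* a (suc m))) (ℤ.+≤+ (far l)))))))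
  where a = ∣ w ℤ.* p ℤ.- l ℤ.* + suc d-1 ∣

≤‖‖⇒Far : ∀ m w p {d-1 x} → toℚᵘ x ℚᵘ.≃ ℚᵘ.mkℚᵘ p d-1 → + 1 ℚ./ suc m ℚ.≤ ‖ w ℚ./ 1 ℚ.* x ‖ℚ →
          Far (suc m) (w ℤ.* p) (suc d-1)
≤‖‖⇒Far m w p {d-1} {x} x≃p/d 1/m≤ l
  with ℚᵘ.≤-respˡ-≃ (toℚᵘ-/ (+ 1) m) (ℚᵘ.≤-respʳ-≃ (toℚᵘ-distance w l x≃p/d)
         (ℚ.toℚᵘ-mono-≤ (ℚ.≤-trans 1/m≤ (‖‖ℚ-minimal (w ℚ./ 1 ℚ.* x) l))))
... | ℚᵘ.*≤* le = ℤ.drop‿+≤+ (subst₂ ℤ._≤_ (ℤ.*-identityˡ (+ suc d-1))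
    (trans (sym (ℤ.pos-* a (suc m))) (cong +_ (ℕ.*-comm a (suc m)))) le)
  where a = ∣ w ℤ.* p ℤ.- l ℤ.* + suc d-1 ∣

-- The strict bound with slack 1 / e, e = `suc e-1`, is what `_≤ℝ_` provides. Clearing denominators
-- gives the hypothesis of `round-time` when e = 2 D.
<‖‖+⇒ : ∀ m e-1 w p {d-1 x} → toℚᵘ x ℚᵘ.≃ ℚᵘ.mkℚᵘ p d-1 →
  + 1 ℚ./ suc m ℚ.< ‖ w ℚ./ 1 ℚ.* x ‖ℚ ℚ.+ + 1 ℚ./ suc e-1 →
  ∀ l → suc e-1 * suc d-1 < suc m * (suc e-1 * ∣ w ℤ.* p ℤ.- l ℤ.* + suc d-1 ∣ + suc d-1)
<‖‖+⇒ m e-1 w p {d-1} {x} x≃p/d 1/m< l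
  with ℚᵘ.<-respˡ-≃ (toℚᵘ-/ (+ 1) m) (ℚᵘ.<-respʳ-≃
         (ℚᵘ.≃-trans (ℚ.toℚᵘ-homo-+ ℚ.∣ w ℚ./ 1 ℚ.* x ℚ.- l ℚ./ 1 ∣ (+ 1 ℚ./ suc e-1)) (ℚᵘ.+-cong (toℚᵘ-distance w l x≃p/d) (toℚᵘ-/ (+ 1) e-1)))
         (ℚ.toℚᵘ-mono-< (ℚ.<-≤-trans 1/m<
           (ℚ.+-monoˡ-≤ (+ 1 ℚ./ suc e-1) (‖‖ℚ-minimal (w ℚ./ 1 ℚ.* x) l)))))
... | ℚᵘ.*<* lt = ℤ.drop‿+<+ (subst₂ ℤ._<_
    (trans (ℤ.*-identityˡ _) (cong +_ (ℕ.*-comm (suc d-1) (suc e-1))))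
    (trans (cong (ℤ._* + suc m) (cong₂ ℤ._+_ (sym (ℤ.pos-* a (suc e-1))) (ℤ.*-identityˡ (+ suc d-1))))
      (trans (sym (ℤ.pos-* (a * suc e-1 + suc d-1) (suc m)))
        (cong +_ (trans (ℕ.*-comm _ (suc m)) (cong (λ b → suc m * (b + suc d-1)) (ℕ.*-comm a (suc e-1)))))))
    lt)
  where a = ∣ w ℤ.* p ℤ.- l ℤ.* + suc d-1 ∣

-- Rounding p / q to the grid ℤ / D, which contains every endpoint of the set of
-- times t with ‖ w t ‖ ≥ 1 / n, removes an error of 1 / (2 D) completely.
round-time : ∀ n w U′ p q g {D} → D ≡ n * (w * U′) → 0 < q → 0 < w →
  2 * ∣ + D ℤ.* p ℤ.- g ℤ.* + q ∣ ≤ q →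
  (∀ l → 2 * D * q < n * (2 * D * ∣ + w ℤ.* p ℤ.- l ℤ.* + q ∣ + q)) →
  Far n (+ w ℤ.* g) D
round-time n w U′ p q g refl 0<q 0<w g-near far l = begin
  n * (w * U′)                        ≤⟨ ℕ.*-monoʳ-≤ n (ℕ.*-monoʳ-≤ w (ℕ.s≤s⁻¹ U′<β+1)) ⟩
  n * (w * β)                         ≡⟨ cong (n *_) b≡wβ ⟨
  n * b                               ∎
  where
  open ℕ.≤-Reasoning
  D = n * (w * U′)
  a = + w ℤ.* p ℤ.- l ℤ.* + q
  b = ∣ + w ℤ.* g ℤ.- l ℤ.* + D ∣
  y = + D ℤ.* p ℤ.- g ℤ.* + q
  β = ∣ g ℤ.- l ℤ.* (+ n ℤ.* + U′) ∣

  +D : + D ≡ + n ℤ.* (+ w ℤ.* + U′)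
  +D = trans (ℤ.pos-* n (w * U′)) (cong (λ x → + n ℤ.* x) (ℤ.pos-* w U′))

  b≡wβ : b ≡ w * β
  b≡wβ = trans (cong ∣_∣ (trans (cong (λ x → + w ℤ.* g ℤ.- l ℤ.* x) +D) (ring (+ w) g l (+ n) (+ U′))))
               (ℤ.abs-* (+ w) _)
    where
    ring : ∀ w g l n u → w ℤ.* g ℤ.- l ℤ.* (n ℤ.* (w ℤ.* u)) ≡ w ℤ.* (g ℤ.- l ℤ.* (n ℤ.* u))
    ring = ℤ.solve-∀

  Da≤ : D * ∣ a ∣ ≤ q * b + w * ∣ y ∣
  Da≤ = begin
    D * ∣ a ∣
      ≡⟨ ℤ.abs-* (+ D) a ⟨
    ∣ + D ℤ.* a ∣
      ≡⟨ cong ∣_∣ (ring (+ D) (+ w) p l (+ q) g) ⟩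
    ∣ + q ℤ.* (+ w ℤ.* g ℤ.- l ℤ.* + D) ℤ.+ + w ℤ.* y ∣
      ≤⟨ ℤ.∣i+j∣≤∣i∣+∣j∣ (+ q ℤ.* (+ w ℤ.* g ℤ.- l ℤ.* + D)) (+ w ℤ.* y) ⟩
    ∣ + q ℤ.* (+ w ℤ.* g ℤ.- l ℤ.* + D) ∣ + ∣ + w ℤ.* y ∣
      ≡⟨ cong₂ _+_ (ℤ.abs-* (+ q) _) (ℤ.abs-* (+ w) y) ⟩
    q * b + w * ∣ y ∣ ∎
    where
    ring : ∀ d w p l q g → d ℤ.* (w ℤ.* p ℤ.- l ℤ.* q)
           ≡ q ℤ.* (w ℤ.* g ℤ.- l ℤ.* d) ℤ.+ w ℤ.* (d ℤ.* p ℤ.- g ℤ.* q)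
    ring = ℤ.solve-∀

  -- Both `D` and w g - l D are multiples of w, so the claim amounts to U′ ≤ β. The rounding and the
  -- slack 1 / (2 D) each cost at most half a unit of β, and integrality recovers the loss.
  U′<β+1 : U′ < suc β
  U′<β+1 = ℕ.*-cancelˡ-< (2 * n * w * q) U′ (suc β) (begin-strict
    2 * n * w * q * U′                      ≡⟨ nat₁ n w q U′ ⟩
    2 * D * q                               <⟨ far l ⟩
    n * (2 * D * ∣ a ∣ + q)                 ≡⟨ cong (λ x → n * (x + q)) (ℕ.*-assoc 2 D ∣ a ∣) ⟩
    n * (2 * (D * ∣ a ∣) + q)               ≤⟨ ℕ.*-monoʳ-≤ n (ℕ.+-monoˡ-≤ q (ℕ.*-monoʳ-≤ 2 Da≤)) ⟩
    n * (2 * (q * b + w * ∣ y ∣) + q)       ≡⟨ nat₂ n q b w ∣ y ∣ ⟩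
    n * (2 * q * b + w * (2 * ∣ y ∣) + q)   ≤⟨ ℕ.*-monoʳ-≤ n (ℕ.+-mono-≤ (ℕ.+-monoʳ-≤ (2 * q * b) (ℕ.*-monoʳ-≤ w g-near))
                                                 (subst (_≤ w * q) (ℕ.*-identityˡ q) (ℕ.*-monoˡ-≤ q 0<w))) ⟩
    n * (2 * q * b + w * q + w * q)         ≡⟨ cong (λ x → n * (2 * q * x + w * q + w * q)) b≡wβ ⟩
    n * (2 * q * (w * β) + w * q + w * q)   ≡⟨ nat₃ n q w β ⟩
    2 * n * w * q * suc β                   ∎)
    where
    nat₁ : ∀ n w q u → 2 * n * w * q * u ≡ 2 * (n * (w * u)) * q
    nat₁ = ℕ.solve-∀
    nat₂ : ∀ n q b w y → n * (2 * (q * b + w * y) + q) ≡ n * (2 * q * b + w * (2 * y) + q)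
    nat₂ = ℕ.solve-∀
    nat₃ : ∀ n q w β → n * (2 * q * (w * β) + w * q + w * q) ≡ 2 * n * w * q * suc β
    nat₃ = ℕ.solve-∀

eventually : ∀ {m} {P : Fin m → ℕ → Set} → (∀ i → ∃ λ N → ∀ n → N ≤ n → P i n) →
             ∃ λ N → ∀ n → N ≤ n → ∀ i → P i n
eventually {zero} ev = 0 , λ _ _ ()
eventually {suc m} {P} ev =
  let N₀ , tail₀ = ev zero
      N , tail   = eventually {P = P ∘ suc} (ev ∘ suc)
  in N₀ ℕ.⊔ N , λ n N≤n → λ where
       zero    → tail₀ n (ℕ.m⊔n≤o⇒m≤o N₀ N N≤n)
       (suc i) → tail n (ℕ.m⊔n≤o⇒n≤o N₀ N N≤n) i

fromℕ≄0 : ∀ {w} → 0 < w → ¬ fromℕ w ≃ℝ fromℕ 0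
fromℕ≄0 {w} 0<w w≃0 with w≃0 1ℚ (ℚ.positive⁻¹ 1ℚ)
... | N , close with ℚᵘ.<-respˡ-≃ (toℚᵘ-distance (+ w) (+ 0) {1ℚ} {+ 1} {0} ℚᵘ.≃-refl)
        (ℚ.toℚᵘ-mono-< (subst (λ x → ℚ.∣ x ℚ.- + 0 ℚ./ 1 ∣ ℚ.< 1ℚ) (sym (ℚ.*-identityʳ (+ w ℚ./ 1)))
          (close N ℕ.≤-refl)))
... | ℚᵘ.*<* lt = ℕ.<⇒≱ (ℤ.drop‿+<+ (subst (ℤ._< + 1)
        (trans (ℤ.*-identityʳ _) (cong (λ x → + ∣ x ∣) (ring (+ w)))) lt)) 0<w
  where
  ring : ∀ w → w ℤ.* + 1 ℤ.- + 0 ℤ.* + 1 ≡ w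
  ring = ℤ.solve-∀

0<1/ : ∀ d-1 → 0ℚ ℚ.< + 1 ℚ./ suc d-1
0<1/ d-1 = ℚ.toℚᵘ-cancel-< (ℚᵘ.<-respʳ-≃ (ℚᵘ.≃-sym (toℚᵘ-/ (+ 1) d-1)) (ℚᵘ.positive⁻¹ (ℚᵘ.mkℚᵘ (+ 1) d-1)))

toℚᵘ-↥↧ : ∀ x → toℚᵘ x ℚᵘ.≃ ℚᵘ.mkℚᵘ (ℚ.↥ x) (ℚ.denominator-1 x)
toℚᵘ-↥↧ record{} = ℚᵘ.≃-refl

-- The conjecture for positive integer velocities

module IntegralVelocities {m} (lrc : LonelyRunnerConjecture (suc m))
                          (w : Vector ℕ m) (w-pos : ∀ k → 0 < w k) where

  -- An endpoint of the set where ‖ w k t ‖ ≥ 1 / (m + 1) has the form (l ± 1 / (m + 1)) / w k. As w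
  -- k divides `U`, it is a multiple of 1 / D.
  U D : ℕ
  U = product (tabulate w)
  D = suc m * U

  instance
    U-nonZero : NonZero U
    U-nonZero = product≢0 (All.tabulate⁺ (ℕ.>-nonZero ∘ w-pos))

    D-nonZero : NonZero D
    D-nonZero = ℕ.m*n≢0 (suc m) U

    2D-nonZero : NonZero (2 * D)
    2D-nonZero = ℕ.m*n≢0 2 D

  -- A sufficiently late term of the Cauchy sequence of `t` works for all finitely many k at once.
  -- The slack 1 / (2 D) is the most that the later rounding can absorb.
  rational-approximation : ∀ t → LonelyAt (fromℕ ∘ w) t → ∃ λ x →
    ∀ k → + 1 ℚ./ suc m ℚ.< ‖ + w k ℚ./ 1 ℚ.* x ‖ℚ ℚ.+ + 1 ℚ./ suc (ℕ.pred (2 * D))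
  rational-approximation t lonely =
    let N , tail = eventually (λ k → lonely k (+ 1 ℚ./ suc (ℕ.pred (2 * D))) (0<1/ (ℕ.pred (2 * D))))
    in seq t N , tail N ℕ.≤-refl

  Lonely : ℤ → Set
  Lonely a = ∀ k → Far (suc m) (+ w k ℤ.* a) D

  lonely-round : ∀ t → LonelyAt (fromℕ ∘ w) t → ∃ Lonely
  lonely-round t lonely =
    let x , close  = rational-approximation t lonely
        g , g-near = nearest (+ D ℤ.* ℚ.↥ x) (ℚ.↧ₙ x)
    in g , λ k → let divides U′ U≡U′w = ∈⇒∣product (∈-tabulate⁺ {f = w} k) in
      round-time (suc m) (w k) U′ (ℚ.↥ x) (ℚ.↧ₙ x) g
        (cong (suc m *_) (trans U≡U′w (ℕ.*-comm U′ (w k)))) ℕ.z<s (w-pos k) g-near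
        λ l → subst (λ e → e * ℚ.↧ₙ x < suc m * (e * ∣ + w k ℤ.* ℚ.↥ x ℤ.- l ℤ.* ℚ.↧ x ∣ + ℚ.↧ₙ x))
          (ℕ.suc-pred (2 * D)) (<‖‖+⇒ m (ℕ.pred (2 * D)) (+ w k) (ℚ.↥ x) (toℚᵘ-↥↧ x) (close k) l)

  -- Changing `a` by `D` changes the time by 1 and every position by an integer, so the search can
  -- be confined to 0 ≤ a < D.
  lonely-% : ∀ a → Lonely a → Lonely (+ (a ℤ.%ℕ D))
  lonely-% a lonely k l = subst (λ x → D ≤ suc m * ∣ x ∣)
    (reduce (ℤ.a≡a%ℕn+[a/ℕn]*n a D)) (lonely k (l ℤ.+ + w k ℤ.* (a ℤ./ℕ D)))
    where
    ring : ∀ w r q l d → w ℤ.* (r ℤ.+ q ℤ.* d) ℤ.- (l ℤ.+ w ℤ.* q) ℤ.* d ≡ w ℤ.* r ℤ.- l ℤ.* d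
    ring = ℤ.solve-∀
    reduce : ∀ {a r} → a ≡ r ℤ.+ (a ℤ./ℕ D) ℤ.* + D →
      + w k ℤ.* a ℤ.- (l ℤ.+ + w k ℤ.* (a ℤ./ℕ D)) ℤ.* + D ≡ + w k ℤ.* r ℤ.- l ℤ.* + D
    reduce {a} {r} eq = trans
      (cong (λ x → + w k ℤ.* x ℤ.- (l ℤ.+ + w k ℤ.* (a ℤ./ℕ D)) ℤ.* + D) eq)
      (ring (+ w k) r (a ℤ./ℕ D) l (+ D))

  -- `Far` quantifies over all integers; it is decided through the equivalent comparison of two
  -- rationals.
  lonely? : ∀ a → Dec (Lonely a)
  lonely? a = Fin.all? λ k → map′ (far k) (near k)
    (+ 1 ℚ./ suc m ℚ.≤? ‖ + w k ℚ./ 1 ℚ.* (a ℚ./ suc (ℕ.pred D)) ‖ℚ)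
    where
    far : ∀ k → + 1 ℚ./ suc m ℚ.≤ ‖ + w k ℚ./ 1 ℚ.* (a ℚ./ suc (ℕ.pred D)) ‖ℚ → Far (suc m) (+ w k ℤ.* a) D
    far k 1/n≤ = subst (Far (suc m) (+ w k ℤ.* a)) (ℕ.suc-pred D) (≤‖‖⇒Far m (+ w k) a (toℚᵘ-/ a (ℕ.pred D)) 1/n≤)
    near : ∀ k → Far (suc m) (+ w k ℤ.* a) D → + 1 ℚ./ suc m ℚ.≤ ‖ + w k ℚ./ 1 ℚ.* (a ℚ./ suc (ℕ.pred D)) ‖ℚ
    near k lonely = Far⇒≤‖‖ m (+ w k) a (toℚᵘ-/ a (ℕ.pred D)) (subst (Far (suc m) (+ w k ℤ.* a)) (sym (ℕ.suc-pred D)) lonely)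

  lonely-time : ∃ Lonely
  lonely-time =
    -- Existence among `D` candidates is decidable, hence stable, and the double negation in the
    -- conjecture can be removed.
    let r , lonely = decidable-stable (Fin.any? {D} λ r → lonely? (+ toℕ r)) λ none →
          lrc (fromℕ ∘ w) (fromℕ≄0 ∘ w-pos) λ (t , lonely) →
          let a , lonelyₐ = lonely-round t lonely
          in none (fromℕ< (ℤ.n%ℕd<d a D) ,
                   subst (Lonely ∘ +_) (sym (Fin.toℕ-fromℕ< (ℤ.n%ℕd<d a D))) (lonely-% a lonelyₐ))
    in + toℕ r , lonely

integral-lonely-time : ∀ {m} → LonelyRunnerConjecture (suc m) →
  (w : Vector ℕ m) → (∀ k → 0 < w k) →
  FarTime (suc m) (+_ ∘ w)
integral-lonely-time lrc w w-pos = proj₁ lonely-time , D , ℕ.>-nonZero⁻¹ D , proj₂ lonely-time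
  where open IntegralVelocities lrc w w-pos

-- Deduction of the theorem

2*[1+n]C2 : ∀ n → 2 * (suc n C 2) ≡ n * suc n
2*[1+n]C2 zero    = refl
2*[1+n]C2 (suc n) = begin
  2 * (suc (suc n) C 2)           ≡⟨ cong (2 *_) (nCk+nC[k+1]≡[n+1]C[k+1] (suc n) 1) ⟨
  2 * (suc n C 1 + suc n C 2)     ≡⟨ ℕ.*-distribˡ-+ 2 (suc n C 1) (suc n C 2) ⟩
  2 * (suc n C 1) + 2 * (suc n C 2) ≡⟨ cong₂ (λ x y → 2 * x + y) (nC1≡n (suc n)) (2*[1+n]C2 n) ⟩
  2 * suc n + n * suc n           ≡⟨ ring n ⟩
  suc n * suc (suc n)             ∎
  where
  open ≡-Reasoning
  ring : ∀ n → 2 * suc n + n * suc n ≡ suc n * suc (suc n)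
  ring = ℕ.solve-∀

FarTime⇒lonely : ∀ {n} (v : Vector ℕ n) → FarTime (suc n) (+_ ∘ v) → ∃ (LonelyAt (fromℕ ∘ v))
FarTime⇒lonely {n} v (a , suc d-1 , _ , far) = fromℚ (a ℚ./ suc d-1) , λ k ε 0<ε → 0 , λ _ _ →
  ℚ.≤-<-trans (Far⇒≤‖‖ n (+ v k) a (toℚᵘ-/ a d-1) (far k))
    (subst (ℚ._< ‖va/d‖ k ℚ.+ ε) (ℚ.+-identityʳ (‖va/d‖ k)) (ℚ.+-monoʳ-< (‖va/d‖ k) 0<ε))
  where
  ‖va/d‖ : Fin n → ℚ
  ‖va/d‖ k = ‖ + v k ℚ./ 1 ℚ.* (a ℚ./ suc d-1) ‖ℚ

-- Since u j = - u i, the velocity u j can be dropped.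
drop-opposite : ∀ {m} → LonelyRunnerConjecture (suc m) → ∀ (u : Vector ℤ (suc m)) →
  (∀ k → u k ≢ + 0) → ∀ {i j} → i ≢ j → u j ≡ ℤ.- u i → FarTime (suc m) u
drop-opposite {m} lrc u u≢0 {i} {j} i≢j uⱼ≡-uᵢ = extend (integral-lonely-time lrc
    (λ l → ∣ u (punchIn j l) ∣) (λ l → ℕ.n≢0⇒n>0 (u≢0 (punchIn j l) ∘ ℤ.∣i∣≡0⇒i≡0)))
  where
  extend : FarTime (suc m) (λ l → + ∣ u (punchIn j l) ∣) → FarTime (suc m) u
  extend (A , D , 0<D , far-punchIn) = A , D , 0<D , far
    where
    far-≢ : ∀ {k} → j ≢ k → Far (suc m) (u k ℤ.* A) D
    far-≢ {k} j≢k = subst (λ k → Far (suc m) (u k ℤ.* A) D) (Fin.punchIn-punchOut j≢k)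
      (Far-abs {suc m} (u (punchIn j (punchOut j≢k))) A (far-punchIn (punchOut j≢k)))

    far : ∀ k → Far (suc m) (u k ℤ.* A) D
    far k with j Fin.≟ k
    ... | no  j≢k  = far-≢ j≢k
    ... | yes refl = subst (λ x → Far (suc m) x D)
      (trans (ℤ.neg-distribˡ-* (u i) A) (cong (ℤ._* A) (sym uⱼ≡-uᵢ)))
      (Far-neg {suc m} {u i ℤ.* A} (far-≢ (i≢j ∘ sym)))

ShortVector⇒FarTime : ∀ {m} → LonelyRunnerConjecture (suc m) → (v : Vector ℕ (suc m)) → (∀ i → 0 < v i) →
  ∀ {N} → 2 * N ≡ suc m * suc (suc m) → ShortVector v N → FarTime (suc (suc m)) (+_ ∘ v)
ShortVector⇒FarTime {m} lrc v v-pos {N} 2N≡ (z , z∦v , G , K , 0<G , z-close) =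
  from-mediant (∃-mediant≢0 z∦v)
  where
  open Slopes z v v-pos

  0<N : 0 < N
  0<N = ℕ.n≢0⇒n>0 λ { refl → ℕ.0≢1+n 2N≡ }

  from-nearest : ∀ c e A D → 0 < D → (∀ k → Far (suc m) ((+ v k ℤ.* c ℤ.- z k ℤ.* e) ℤ.* A) D) →
                 (∃ λ h → 2 * ∣ e ℤ.* A ℤ.- h ℤ.* + D ∣ ≤ D) → FarTime (suc (suc m)) (+_ ∘ v)
  from-nearest c e A D 0<D far (h , h-near) =
    c ℤ.* A ℤ.* + (G * N) ℤ.- K ℤ.* (e ℤ.* A ℤ.- h ℤ.* + D) ,
    G * N * D , ℕ.*-mono-≤ (ℕ.*-mono-≤ 0<G 0<N) 0<D ,
    λ k → lift-time {suc m} {N} {G} {D} {A} {K} {c} {e} {h}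
            ℕ.z<s 2N≡ h-near (z k) (+ v k) (z-close k) (far k)

  from-time : ∀ i j → FarTime (suc m) (mediant i j) → FarTime (suc (suc m)) (+_ ∘ v)
  from-time i j (A , D , 0<D , far) =
    -- With c = z i + z j and e = v i + v j, the velocity v k c - z k e is `mediant i j k`.
    from-nearest (z i ℤ.+ z j) (+ v i ℤ.+ + v j) A D 0<D far
      (nearest ((+ v i ℤ.+ + v j) ℤ.* A) D {{ℕ.>-nonZero 0<D}})

  from-mediant : (∃₂ λ i j → i ≢ j × (∀ k → mediant i j k ≢ + 0)) → FarTime (suc (suc m)) (+_ ∘ v)
  from-mediant (i , j , i≢j , u≢0) =
    from-time i j (drop-opposite lrc (mediant i j) u≢0 i≢j (mediant-antisym i j))

theorem1 : (n : ℕ) → 1 ≤ n →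
    LonelyRunnerConjecture n →
    (v : Vector ℕ n) → (∀ i → 0 < v i) →
    gcdOver v ⊤ ≡ 1 →
    (suc n C 2) ^ pred n < ∑gcd v →
    ∃ λ t → LonelyAt (λ i → fromℕ (v i)) t
theorem1 (suc m) _ lrc v v-pos gcd≡1 N^m<∑gcd =
  FarTime⇒lonely v (ShortVector⇒FarTime lrc v v-pos 2N≡
    (short-vector v v-pos gcd≡1 (suc (suc m) C 2) {{N-nonZero}} N^m<∑gcd))
  where
  2N≡ : 2 * (suc (suc m) C 2) ≡ suc m * suc (suc m)
  2N≡ = 2*[1+n]C2 (suc m)

  N-nonZero : NonZero (suc (suc m) C 2)
  N-nonZero = ℕ.≢-nonZero λ N≡0 → ℕ.0≢1+n (trans (cong (2 *_) (sym N≡0)) 2N≡)
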